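{- Let $G$ be a graph with an odd number $n\geq 13$ of vertices. Then $\mathrm{mp}(G)=2n-5$ if and only if $G$ satisfies one of the following conditions: (1) $\delta(G)=n-2$ and $G\neq K_n-e$ for every edge $e$ of $K_n$; (2) $G=K_n-E(P_3)$, i.e., $G$ is obtained from $K_n$ by deleting the two edges of a path on three vertices.
   Context: All graphs are finite, simple and undirected; $\delta(G)$ is the minimum degree, $K_n$ the complete graph on $n$ vertices, $P_3$ a path with three vertices. A perfect matching is a set of edges covering every vertex exactly once; an almost-perfect matching is a set of edges covering every vertex except one exactly once and missing the remaining vertex. The matching preclusion number $\mathrm{mp}(G)$ is the minimum number of edges whose deletion leaves a graph with neither a perfect matching nor an almost-perfect matching ($\mathrm{mp}(G)=0$ if $G$ has neither). -}

module Defs where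

open import Data.Nat using (ℕ; zero; suc; _+_; _*_; _∸_; _≤_; _<_; _≥_; _⊓_; _<ᵇ_; _%_)
open import Data.Bool using (Bool; true; false; if_then_else_; _∧_)
open import Data.Fin using (Fin; toℕ)
open import Data.List using (List; map; foldr; allFin)
open import Data.Nat.ListAction using (sum)
open import Data.Product using (Σ; ∃; _×_; _,_)
open import Data.Sum using (_⊎_)
open import Relation.Nullary using (¬_)
open import Relation.Binary.PropositionalEquality using (_≡_; _≢_)

record Graph (n : ℕ) : Set where
  field
    adj    : Fin n → Fin n → Bool
    sym    : ∀ i j → adj i j ≡ adj j i
    irrefl : ∀ i → adj i i ≡ false
open Graph public

[_] : Bool → ℕ
[ b ] = if b then 1 else 0

deg : ∀ {n} → Graph n → Fin n → ℕ
deg {n} G v = sum (map (λ u → [ adj G v u ]) (allFin n))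

-- minimum degree δ(G) (for n ≥ 1 this is the minimum of the degrees)
δ : ∀ {n} → Graph n → ℕ
δ {n} G = foldr (λ v m → deg G v ⊓ m) n (allFin n)

edgeCount : ∀ {n} → Graph n → ℕ
edgeCount {n} G =
  sum (map (λ i → sum (map (λ j → [ adj G i j ∧ (toℕ i <ᵇ toℕ j) ]) (allFin n))) (allFin n))

_⊆G_ : ∀ {n} → Graph n → Graph n → Set
H ⊆G G = ∀ i j → adj H i j ≡ true → adj G i j ≡ true

IsMatching : ∀ {n} → Graph n → Graph n → Set
IsMatching G M = M ⊆G G × (∀ v → deg M v ≤ 1)

IsPerfectMatching : ∀ {n} → Graph n → Graph n → Set
IsPerfectMatching G M = M ⊆G G × (∀ v → deg M v ≡ 1)

IsAlmostPerfectMatching : ∀ {n} → Graph n → Graph n → Set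
IsAlmostPerfectMatching G M =
  M ⊆G G × Σ (Fin _) (λ w → deg M w ≡ 0 × (∀ v → v ≢ w → deg M v ≡ 1))

HasPMorAPM : ∀ {n} → Graph n → Set
HasPMorAPM G = Σ (Graph _) (λ M → IsPerfectMatching G M ⊎ IsAlmostPerfectMatching G M)

-- mp(G) ≡ m : m is the minimum number of edges of G whose deletion leaves a graph
-- with neither a perfect nor an almost-perfect matching.
-- Deleting an edge set F ⊆ E(G) leaves a spanning subgraph H with |F| = |E(G)| - |E(H)|.
MatchingPreclusionNumber : ∀ {n} → Graph n → ℕ → Set
MatchingPreclusionNumber G m =
  Σ (Graph _) (λ H → H ⊆G G × edgeCount G ∸ edgeCount H ≡ m × ¬ HasPMorAPM H)
  × (∀ H → H ⊆G G → edgeCount G ∸ edgeCount H < m → HasPMorAPM H)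

SameEdge : ∀ {n} → Fin n → Fin n → Fin n → Fin n → Set
SameEdge i j a b = (i ≡ a × j ≡ b) ⊎ (i ≡ b × j ≡ a)

IsKnMinusEdge : ∀ {n} → Graph n → Fin n → Fin n → Set
IsKnMinusEdge G a b =
  a ≢ b × (∀ i j → i ≢ j → (adj G i j ≡ false → SameEdge i j a b)
                         × (SameEdge i j a b → adj G i j ≡ false))

IsKnMinusP3 : ∀ {n} → Graph n → Fin n → Fin n → Fin n → Set
IsKnMinusP3 G a b c =
  a ≢ b × b ≢ c × a ≢ c ×
  (∀ i j → i ≢ j → (adj G i j ≡ false → SameEdge i j a b ⊎ SameEdge i j b c)
                 × (SameEdge i j a b ⊎ SameEdge i j b c → adj G i j ≡ false))

{-# OPTIONS --safe #-}

-- Deleting all edges at two vertices a ≠ b destroys every (almost-)perfect matching and costs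
-- 2n − (κ a + κ b + [a ~ b]) edges, where κ v counts the non-neighbours of v, itself included.
-- So mp(G) = 2n − 5 forces κ a + κ b + [a ~ b] ≤ 5 for all a ≠ b, which leaves only complements
-- of matchings and K_n − E(P₃); in both listed cases some pair attains 5.
--
-- Conversely, a graph H missing few edges has an almost-perfect matching.  Start from any pairing
-- of the vertices, add its edges to H, and remove them again one at a time.  If a removal leaves
-- no almost-perfect matching, there is a matching exposing exactly three vertices U, and no
-- augmenting path has at most two matching edges.  Hence each matching edge misses at least 3, 4
-- or 5 of the six edges to U, and the cheap ones force further missing edges among themselves;
-- the total exceeds the number of edges allowed to be missing.

module Submission where

open import Defs renaming (sym to adj-sym)
import Algebra.Solver.CommutativeMonoid as CommutativeMonoidSolver
open import Data.Bool using (Bool; true; false; not; _∧_; _∨_)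
import Data.Bool.Properties as Bool
open import Data.Empty using (⊥; ⊥-elim)
open import Data.Fin using (Fin; toℕ; combine; remQuot)
open import Data.Fin.Patterns using (0F; 1F; 2F)
open import Data.Fin.Properties using (_≟_; any?; all?; remQuot-combine; toℕ-injective)
open import Data.Fin.Subset using (Subset)
open import Data.Fin.Subset.Properties using (anySubset?)
open import Data.List using (List; []; _∷_; _++_; map; foldr; length; allFin; tabulate)
open import Data.List.Properties using (map-++; map-cong; length-map; length-++; length-tabulate)
  renaming (++-identityʳ to ++-identityʳ-≡)
import Data.List.Membership.DecPropositional as DecMembership
open import Data.List.Membership.Propositional using (_∈_; _∉_; find)
open import Data.List.Membership.Propositional.Properties using (∈-∃++; ∈-++⁺ʳ; ∈-allFin; ∈-map⁻)
open import Data.List.Relation.Binary.Permutation.Propositional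
  using (_↭_; prep; swap; ↭-refl; ↭-sym; ↭-trans; ↭-reflexive; ↭⇒↭ₛ; module PermutationReasoning)
open import Data.List.Relation.Binary.Permutation.Propositional.Properties
  using ( shift; shifts; map⁺; ++⁺; ++⁺ˡ; ++⁺ʳ; ++-assoc; ++-comm; ++-identityʳ; ++-commutativeMonoid
        ; ∈-resp-↭; All-resp-↭; ↭-length)
import Data.List.Relation.Binary.Permutation.Setoid.Properties as Setoid↭
open import Data.List.Relation.Unary.All as All using (All; []; _∷_)
open import Data.List.Relation.Unary.AllPairs using ([]; _∷_)
open import Data.List.Relation.Unary.Any using (here; there)
open import Data.List.Relation.Unary.Unique.Propositional using (Unique)
open import Data.List.Relation.Unary.Unique.Propositional.Properties
  using (allFin⁺; Unique[x∷xs]⇒x∉xs)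
open import Data.Nat
  using (ℕ; zero; suc; _+_; _*_; _∸_; _⊓_; _/_; _%_; _≤_; _<_; _<ᵇ_; z≤n; s≤s; s≤s⁻¹)
open import Data.Nat.DivMod using (m≡m%n+[m/n]*n)
open import Data.Nat.ListAction using (sum)
open import Data.Nat.ListAction.Properties using (sum-++; sum-↭)
open import Data.Nat.Properties renaming (_≟_ to _≟ℕ_)
open import Data.Nat.Tactic.RingSolver using (solve-∀)
open import Data.Product using (Σ; ∃; _×_; _,_; proj₁; proj₂; uncurry)
open import Data.Sum using (_⊎_; inj₁; inj₂)
import Data.Vec as Vec
open import Data.Vec.Properties using (lookup∘tabulate)
open import Function using (_∘_)
open import Function.Bundles using (_⇔_; mk⇔; Equivalence)
open import Relation.Binary.Definitions using (tri<; tri≈; tri>)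
open import Relation.Binary.PropositionalEquality
  using ( _≡_; _≢_; _≗_; refl; sym; trans; cong; cong₂; subst; subst₂; setoid
        ; module ≡-Reasoning)
open import Relation.Nullary using (¬_; Dec; yes; no; does; contradiction)
open import Relation.Nullary.Decidable
  using (dec-true; dec-false; decidable-stable; does-⇔; map′; toSum; ¬?; _×-dec_; _⊎-dec_; _→-dec_)

-- With `k` matching edges beside three exposed vertices, `n = 3 + 2k`, so the target `2n - 3`
-- equals `3 + 4k`: three missing pairs inside `U` and, on average, four per matching edge. A leaf
-- falls one short of four, a triangle meets it exactly, a poor edge has one to spare. The shortfall
-- is linear in the number of leaves while the missing pairs among leaf ends grow quadratically, so
-- only few leaves are delicate. Triangles alone give no surplus and are settled by whether their
-- apexes coincide. The obstacle is that the complement of a matching may already miss about n/2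
-- edges, more than a count of all missing edges can afford. So only deletions are counted, and only
-- on pairs meeting a chosen set of vertices, where an allowance of `c` absent edges per vertex
-- suffices; `c = 1` serves complements of matchings. With `c = 0` absent edges are counted like
-- deleted ones, which serves K_n minus P_3, whose centre has two non-neighbours.

private variable
  n : ℕ
  A B : Set
  xs ys zs : List A

-- Sums over lists

∑ : (A → ℕ) → List A → ℕ
∑ f xs = sum (map f xs)

∑-cong : {f g : A → ℕ} → f ≗ g → (xs : List A) → ∑ f xs ≡ ∑ g xs
∑-cong f≗g xs = cong sum (map-cong f≗g xs)

∑-mono-∈ : {f g : A → ℕ} (xs : List A) → (∀ x → x ∈ xs → f x ≤ g x) → ∑ f xs ≤ ∑ g xs
∑-mono-∈ [] _ = z≤n
∑-mono-∈ (x ∷ xs) f≤g = +-mono-≤ (f≤g x (here refl)) (∑-mono-∈ xs λ y → f≤g y ∘ there)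

∑-mono : {f g : A → ℕ} → (∀ x → f x ≤ g x) → (xs : List A) → ∑ f xs ≤ ∑ g xs
∑-mono f≤g xs = ∑-mono-∈ xs λ x _ → f≤g x

∑-const : (c : ℕ) (xs : List A) → ∑ (λ _ → c) xs ≡ length xs * c
∑-const c [] = refl
∑-const c (_ ∷ xs) = cong (c +_) (∑-const c xs)

∑-≥ : {f : A → ℕ} (c : ℕ) (xs : List A) → (∀ x → x ∈ xs → c ≤ f x) → length xs * c ≤ ∑ f xs
∑-≥ c xs c≤f = ≤-trans (≤-reflexive (sym (∑-const c xs))) (∑-mono-∈ xs c≤f)

∑-≤ : {f : A → ℕ} (c : ℕ) (xs : List A) → (∀ x → x ∈ xs → f x ≤ c) → ∑ f xs ≤ length xs * c
∑-≤ c xs f≤c = ≤-trans (∑-mono-∈ xs f≤c) (≤-reflexive (∑-const c xs))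

∑-distrib-+ : (f g : A → ℕ) (xs : List A) → ∑ (λ x → f x + g x) xs ≡ ∑ f xs + ∑ g xs
∑-distrib-+ f g [] = refl
∑-distrib-+ f g (x ∷ xs) rewrite ∑-distrib-+ f g xs = interchange (f x) (g x) (∑ f xs) (∑ g xs)
  where
  interchange : ∀ a b c d → (a + b) + (c + d) ≡ (a + c) + (b + d)
  interchange = solve-∀

∑-++ : (f : A → ℕ) (xs ys : List A) → ∑ f (xs ++ ys) ≡ ∑ f xs + ∑ f ys
∑-++ f xs ys rewrite map-++ f xs ys = sum-++ (map f xs) (map f ys)

∑-↭ : (f : A → ℕ) → xs ↭ ys → ∑ f xs ≡ ∑ f ys
∑-↭ f xs↭ys = sum-↭ (map⁺ f xs↭ys)

∑-swap : (f : A → B → ℕ) (xs : List A) (ys : List B) →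
  ∑ (λ x → ∑ (f x) ys) xs ≡ ∑ (λ y → ∑ (λ x → f x y) xs) ys
∑-swap f [] ys = sym (trans (∑-const 0 ys) (*-zeroʳ (length ys)))
∑-swap f (x ∷ xs) ys rewrite ∑-swap f xs ys = sym (∑-distrib-+ (f x) (λ y → ∑ (λ z → f z y) xs) ys)

-- Pairs are pairs of positions, each taken once. For a symmetric indicator on `allFin n` this
-- counts edges without comparing vertices.
pairSum : (A → A → ℕ) → List A → ℕ
pairSum f [] = 0
pairSum f (x ∷ xs) = ∑ (f x) xs + pairSum f xs

cross : (A → B → ℕ) → List A → List B → ℕ
cross f xs ys = ∑ (λ x → ∑ (f x) ys) xs

pairSum-mono : {f g : A → A → ℕ} → (∀ x y → f x y ≤ g x y) → (xs : List A) →
  pairSum f xs ≤ pairSum g xs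
pairSum-mono f≤g [] = z≤n
pairSum-mono f≤g (x ∷ xs) = +-mono-≤ (∑-mono (f≤g x) xs) (pairSum-mono f≤g xs)

pairSum-cong : {f g : A → A → ℕ} → (∀ x y → f x y ≡ g x y) → (xs : List A) →
  pairSum f xs ≡ pairSum g xs
pairSum-cong f≗g [] = refl
pairSum-cong f≗g (x ∷ xs) = cong₂ _+_ (∑-cong (f≗g x) xs) (pairSum-cong f≗g xs)

pairSum-distrib-+ : (f g : A → A → ℕ) (xs : List A) →
  pairSum (λ x y → f x y + g x y) xs ≡ pairSum f xs + pairSum g xs
pairSum-distrib-+ f g [] = refl
pairSum-distrib-+ f g (x ∷ xs)
  rewrite ∑-distrib-+ (f x) (g x) xs | pairSum-distrib-+ f g xs =
  interchange (∑ (f x) xs) (∑ (g x) xs) (pairSum f xs) (pairSum g xs)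
  where
  interchange : ∀ a b c d → (a + b) + (c + d) ≡ (a + c) + (b + d)
  interchange = solve-∀

cross-mono : {f g : A → B → ℕ} → (∀ x y → f x y ≤ g x y) → (xs : List A) (ys : List B) →
  cross f xs ys ≤ cross g xs ys
cross-mono f≤g xs ys = ∑-mono (λ x → ∑-mono (f≤g x) ys) xs

cross-distrib-+ : (f g : A → B → ℕ) (xs : List A) (ys : List B) →
  cross (λ x y → f x y + g x y) xs ys ≡ cross f xs ys + cross g xs ys
cross-distrib-+ f g xs ys = trans
  (∑-cong (λ x → ∑-distrib-+ (f x) (g x) ys) xs)
  (∑-distrib-+ (λ x → ∑ (f x) ys) (λ x → ∑ (g x) ys) xs)

cross-++ʳ : (f : A → B → ℕ) (xs : List A) (ys zs : List B) →
  cross f xs (ys ++ zs) ≡ cross f xs ys + cross f xs zs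
cross-++ʳ f xs ys zs = trans
  (∑-cong (λ x → ∑-++ (f x) ys zs) xs)
  (∑-distrib-+ (λ x → ∑ (f x) ys) (λ x → ∑ (f x) zs) xs)

cross-≥ : {f : A → B → ℕ} (c : ℕ) (xs : List A) (ys : List B) →
  (∀ x y → x ∈ xs → y ∈ ys → c ≤ f x y) → length xs * (length ys * c) ≤ cross f xs ys
cross-≥ c xs ys c≤f = ∑-≥ (length ys * c) xs λ x x∈ → ∑-≥ c ys λ y → c≤f x y x∈

pairSum-++ : (f : A → A → ℕ) (xs ys : List A) →
  pairSum f (xs ++ ys) ≡ pairSum f xs + cross f xs ys + pairSum f ys
pairSum-++ f [] ys = refl
pairSum-++ f (x ∷ xs) ys rewrite ∑-++ (f x) xs ys | pairSum-++ f xs ys =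
  rearrange (∑ (f x) xs) (∑ (f x) ys) (pairSum f xs) (cross f xs ys) (pairSum f ys)
  where
  rearrange : ∀ a b c d e → (a + b) + (c + d + e) ≡ a + c + (b + d) + e
  rearrange = solve-∀

-- Lets the vertices be reordered into blocks (exposed vertices, leaf ends, triangles, the rest)
-- before `pairSum-++` splits the count.
pairSum-↭ : (f : A → A → ℕ) → (∀ x y → f x y ≡ f y x) → xs ↭ ys → pairSum f xs ≡ pairSum f ys
pairSum-↭ f f-sym _↭_.refl = refl
pairSum-↭ f f-sym (prep x p) = cong₂ _+_ (∑-↭ (f x) p) (pairSum-↭ f f-sym p)
pairSum-↭ f f-sym (swap {xs} {ys} x y p)
  rewrite ∑-↭ (f x) p | ∑-↭ (f y) p | pairSum-↭ f f-sym p | f-sym x y =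
  rearrange (f y x) (∑ (f x) ys) (∑ (f y) ys) (pairSum f ys)
  where
  rearrange : ∀ a b c d → a + b + (c + d) ≡ a + c + (b + d)
  rearrange = solve-∀
pairSum-↭ f f-sym (_↭_.trans p q) = trans (pairSum-↭ f f-sym p) (pairSum-↭ f f-sym q)

-- The handshake identity: it turns edge counts into sums of rows, where bounds at single vertices
-- apply.
cross-diagonal : (f : A → A → ℕ) → (∀ x y → f x y ≡ f y x) → (xs : List A) →
  cross f xs xs ≡ 2 * pairSum f xs + ∑ (λ x → f x x) xs
cross-diagonal f f-sym [] = refl
cross-diagonal f f-sym (x ∷ xs)
  rewrite ∑-distrib-+ (λ y → f y x) (λ y → ∑ (f y) xs) xs
        | ∑-cong (λ y → f-sym y x) xs
        | cross-diagonal f f-sym xs =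
  rearrange (f x x) (∑ (f x) xs) (pairSum f xs) (∑ (λ y → f y y) xs)
  where
  rearrange : ∀ a b c d → a + b + (b + (2 * c + d)) ≡ 2 * (b + c) + (a + d)
  rearrange = solve-∀

∈⇒↭ : {x : A} → x ∈ xs → ∃ λ ys → xs ↭ x ∷ ys
∈⇒↭ x∈xs with ys , zs , refl ← ∈-∃++ x∈xs = ys ++ zs , shift _ ys zs

-- The bound is the binomial coefficient `l(l - 1)/2`, doubled to avoid subtraction and division.
-- Writing two positions as a permutation `x ∷ y ∷ ys` gives the form in which a matching can be
-- reordered to put two edges in front.
pairSum-≥ : (f : A → A → ℕ) (xs : List A) →
  (∀ x y ys → xs ↭ x ∷ y ∷ ys → 1 ≤ f x y) →
  length xs * length xs ≤ 2 * pairSum f xs + length xs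
pairSum-≥ f [] _ = z≤n
pairSum-≥ f (x ∷ xs) 1≤f = begin
  suc m * suc m                                    ≡⟨ square m ⟩
  m * m + 2 * (m * 1) + 1                          ≤⟨ +-monoˡ-≤ 1 (+-mono-≤ rec (*-monoʳ-≤ 2 row)) ⟩
  2 * pairSum f xs + m + 2 * ∑ (f x) xs + 1        ≡⟨ rearrange (pairSum f xs) m (∑ (f x) xs) ⟩
  2 * (∑ (f x) xs + pairSum f xs) + suc m          ∎
  where
  open ≤-Reasoning
  m = length xs
  row : m * 1 ≤ ∑ (f x) xs
  row = ∑-≥ 1 xs λ y y∈xs → let ys , xs↭ = ∈⇒↭ y∈xs in 1≤f x y ys (prep x xs↭)
  rec : m * m ≤ 2 * pairSum f xs + m
  rec = pairSum-≥ f xs λ y z ys xs↭ →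
    1≤f y z (x ∷ ys) (↭-trans (prep x xs↭) (↭-trans (swap x y ↭-refl) (prep y (swap x z ↭-refl))))
  square : ∀ m → suc m * suc m ≡ m * m + 2 * (m * 1) + 1
  square = solve-∀
  rearrange : ∀ p m r → 2 * p + m + 2 * r + 1 ≡ 2 * (r + p) + suc m
  rearrange = solve-∀

pairSum-map : (f : B → B → ℕ) (g : A → B) (xs : List A) →
  pairSum f (map g xs) ≡ pairSum (λ x y → f (g x) (g y)) xs
pairSum-map f g [] = refl
pairSum-map f g (x ∷ xs) = cong₂ _+_ (∑-map (f (g x)) xs) (pairSum-map f g xs)
  where
  ∑-map : (h : _ → ℕ) (xs : List _) → ∑ h (map g xs) ≡ ∑ (h ∘ g) xs
  ∑-map h [] = refl
  ∑-map h (x ∷ xs) = cong (h (g x) +_) (∑-map h xs)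

Unique-resp-↭ : xs ↭ ys → Unique xs → Unique ys
Unique-resp-↭ p = Setoid↭.Unique-resp-↭ (setoid _) (↭⇒↭ₛ p)

-- Counting in Fin n, and lists of disjoint edges

Unique-⊆⇒↭-++ : Unique xs → (∀ {x} → x ∈ xs → x ∈ zs) → ∃ λ ys → zs ↭ xs ++ ys
Unique-⊆⇒↭-++ {zs = zs} [] _ = zs , ↭-refl
Unique-⊆⇒↭-++ {xs = x ∷ xs} {zs} uniq@(_ ∷ uniq′) xs⊆zs =
  let zs′ , zs↭ = ∈⇒↭ (xs⊆zs (here refl))
      ys , zs′↭ = Unique-⊆⇒↭-++ uniq′ (tail⊆ zs↭)
  in ys , ↭-trans zs↭ (prep x zs′↭)
  where
  tail⊆ : ∀ {zs′} → zs ↭ x ∷ zs′ → ∀ {y} → y ∈ xs → y ∈ zs′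
  tail⊆ zs↭ y∈xs with ∈-resp-↭ zs↭ (xs⊆zs (there y∈xs))
  ... | here refl = contradiction y∈xs (Unique[x∷xs]⇒x∉xs uniq)
  ... | there y∈zs′ = y∈zs′

Unique-++⇒disjoint : (xs : List A) {ys : List A} → Unique (xs ++ ys) → ∀ {x} → x ∈ xs → x ∉ ys
Unique-++⇒disjoint (x ∷ xs) uniq (here refl) x∈ys =
  Unique[x∷xs]⇒x∉xs uniq (∈-++⁺ʳ xs x∈ys)
Unique-++⇒disjoint (_ ∷ xs) (_ ∷ uniq) (there x∈xs) = Unique-++⇒disjoint xs uniq x∈xs

complement : {xs : List (Fin n)} → Unique xs →
  ∃ λ ys → allFin n ↭ xs ++ ys × (∀ {x} → x ∈ xs → x ∉ ys)
complement {n} {xs} uniq with ys , allFin↭ ← Unique-⊆⇒↭-++ uniq (λ {x} _ → ∈-allFin x) =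
  ys , allFin↭ , Unique-++⇒disjoint xs (Unique-resp-↭ allFin↭ (allFin⁺ n))

not-≢true : ∀ {b} → b ≢ true → b ≡ false
not-≢true {true} b≢ = contradiction refl b≢
not-≢true {false} _ = refl

[]-true : ∀ {b} → b ≡ true → [ b ] ≡ 1
[]-true refl = refl

[]-false : ∀ {b} → b ≡ false → [ b ] ≡ 0
[]-false refl = refl

[not]-false : ∀ {b} → b ≡ false → [ not b ] ≡ 1
[not]-false refl = refl

[]≤1 : ∀ b → [ b ] ≤ 1
[]≤1 true = ≤-refl
[]≤1 false = z≤n

module _ (f : Fin n → Bool) {xs : List (Fin n)} where
  count-≥ : Unique xs → (∀ v → v ∈ xs → f v ≡ true) → length xs ≤ ∑ ([_] ∘ f) (allFin n)
  count-≥ uniq f-true with ys , allFin↭ , _ ← complement uniq = begin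
    length xs                      ≡⟨ *-identityʳ _ ⟨
    length xs * 1                  ≤⟨ ∑-≥ 1 xs (λ v v∈ → ≤-reflexive (sym ([]-true (f-true v v∈)))) ⟩
    ∑ ([_] ∘ f) xs                 ≤⟨ m≤m+n _ _ ⟩
    ∑ ([_] ∘ f) xs + ∑ ([_] ∘ f) ys ≡⟨ ∑-++ ([_] ∘ f) xs ys ⟨
    ∑ ([_] ∘ f) (xs ++ ys)         ≡⟨ ∑-↭ ([_] ∘ f) allFin↭ ⟨
    ∑ ([_] ∘ f) (allFin n)         ∎
    where open ≤-Reasoning

  count-≤ : Unique xs → (∀ v → f v ≡ true → v ∈ xs) → ∑ ([_] ∘ f) (allFin n) ≤ length xs
  count-≤ uniq support with ys , allFin↭ , disjoint ← complement uniq = begin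
    ∑ ([_] ∘ f) (allFin n)          ≡⟨ ∑-↭ ([_] ∘ f) allFin↭ ⟩
    ∑ ([_] ∘ f) (xs ++ ys)          ≡⟨ ∑-++ ([_] ∘ f) xs ys ⟩
    ∑ ([_] ∘ f) xs + ∑ ([_] ∘ f) ys ≤⟨ +-mono-≤ (∑-≤ 1 xs λ v _ → []≤1 (f v)) (∑-≤ 0 ys outside) ⟩
    length xs * 1 + length ys * 0   ≡⟨ cong₂ _+_ (*-identityʳ _) (*-zeroʳ (length ys)) ⟩
    length xs + 0                   ≡⟨ +-identityʳ _ ⟩
    length xs                       ∎
    where
    open ≤-Reasoning
    outside : ∀ v → v ∈ ys → [ f v ] ≤ 0
    outside v v∈ys = ≤-reflexive ([]-false (not-≢true λ fv → disjoint (support v fv) v∈ys))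

count-point : (p : Fin n) → ∑ (λ v → [ does (p ≟ v) ]) (allFin n) ≡ 1
count-point p = ≤-antisym
  (count-≤ (does ∘ (p ≟_)) ([] ∷ []) only)
  (count-≥ (does ∘ (p ≟_)) ([] ∷ []) λ { v (here refl) → dec-true (p ≟ p) refl })
  where
  only : ∀ v → does (p ≟ v) ≡ true → v ∈ p ∷ []
  only v d with yes refl ← p ≟ v = here refl

-- A matching is a plain list of pairs: disjointness is uniqueness of `flat`, and covering is a
-- permutation of `allFin n`.
flat : List (A × A) → List A
flat [] = []
flat ((x , y) ∷ es) = x ∷ y ∷ flat es

length-flat : (es : List (A × A)) → length (flat es) ≡ 2 * length es
length-flat [] = refl
length-flat (_ ∷ es) rewrite length-flat es = double (length es)
  where
  double : ∀ m → suc (suc (2 * m)) ≡ 2 * suc m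
  double = solve-∀

flat-++ : (es fs : List (A × A)) → flat (es ++ fs) ≡ flat es ++ flat fs
flat-++ [] fs = refl
flat-++ ((x , y) ∷ es) fs = cong (λ zs → x ∷ y ∷ zs) (flat-++ es fs)

flat-↭ : {es fs : List (A × A)} → es ↭ fs → flat es ↭ flat fs
flat-↭ _↭_.refl = ↭-refl
flat-↭ (prep (x , y) p) = prep x (prep y (flat-↭ p))
flat-↭ (swap (x , y) (x′ , y′) p) = ↭-trans
  (shifts (x ∷ y ∷ []) (x′ ∷ y′ ∷ []))
  (++⁺ˡ (x′ ∷ y′ ∷ x ∷ y ∷ []) (flat-↭ p))
flat-↭ (_↭_.trans p q) = ↭-trans (flat-↭ p) (flat-↭ q)

-- Second ends come first because in a leaf the second end is the one with no exposed neighbour, and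
-- these ends form the block to be counted.
flat-split : (es : List (A × A)) → flat es ↭ map proj₂ es ++ map proj₁ es
flat-split [] = ↭-refl
flat-split ((x , y) ∷ es) = ↭-trans (swap x y (flat-split es))
  (prep y (↭-sym (shift x (map proj₂ es) (map proj₁ es))))

∑-flat : (f : A → ℕ) (es : List (A × A)) → ∑ f (flat es) ≡ ∑ (λ (x , y) → f x + f y) es
∑-flat f [] = refl
∑-flat f ((x , y) ∷ es) = trans (cong (λ s → f x + (f y + s)) (∑-flat f es)) (sym (+-assoc (f x) (f y) _))

∈-flat⁻ : {v : A} (es : List (A × A)) → v ∈ flat es → ∃ λ e → e ∈ es × (v ≡ proj₁ e ⊎ v ≡ proj₂ e)
∈-flat⁻ (e ∷ es) (here v≡x) = e , here refl , inj₁ v≡x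
∈-flat⁻ (e ∷ es) (there (here v≡y)) = e , here refl , inj₂ v≡y
∈-flat⁻ (_ ∷ es) (there (there v∈)) with e , e∈ , v∈e ← ∈-flat⁻ es v∈ = e , there e∈ , v∈e

∈-flat⁺ : {e : A × A} {es : List (A × A)} → e ∈ es → proj₁ e ∈ flat es
∈-flat⁺ (here refl) = here refl
∈-flat⁺ (there e∈) = there (there (∈-flat⁺ e∈))

flat-pairing : (k : ℕ) (xs : List A) → length xs ≡ 1 + 2 * k →
  ∃ λ w → ∃ λ es → xs ≡ w ∷ flat es
flat-pairing zero (w ∷ []) _ = w , [] , refl
flat-pairing (suc k) (x ∷ []) ()
flat-pairing (suc k) (x ∷ y ∷ xs) len
  with w , es , refl ← flat-pairing k xs
    (suc-injective (suc-injective (trans len (cong suc (*-suc 2 k))))) =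
  x , (y , w) ∷ es , refl

-- From lists of edges to matchings

data Joined {A : Set} : List (A × A) → A → A → Set where
  forward  : ∀ {x y es} → Joined ((x , y) ∷ es) x y
  backward : ∀ {x y es} → Joined ((x , y) ∷ es) y x
  later    : ∀ {e es v w} → Joined es v w → Joined (e ∷ es) v w

module _ {A : Set} where
  Joined-sym : {es : List (A × A)} {v w : A} → Joined es v w → Joined es w v
  Joined-sym forward = backward
  Joined-sym backward = forward
  Joined-sym (later j) = later (Joined-sym j)

  Joined⇒∈ : {es : List (A × A)} {v w : A} → Joined es v w → v ∈ flat es
  Joined⇒∈ forward = here refl
  Joined⇒∈ backward = there (here refl)
  Joined⇒∈ (later j) = there (there (Joined⇒∈ j))

  ∈⇒Joined : (es : List (A × A)) {v : A} → v ∈ flat es → ∃ (Joined es v)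
  ∈⇒Joined ((x , y) ∷ es) (here refl) = y , forward
  ∈⇒Joined ((x , y) ∷ es) (there (here refl)) = x , backward
  ∈⇒Joined (_ ∷ es) (there (there v∈)) = let w , j = ∈⇒Joined es v∈ in w , later j

  Joined-functional : {es : List (A × A)} {v w w′ : A} → Unique (flat es) →
    Joined es v w → Joined es v w′ → w ≡ w′
  Joined-functional {es = _ ∷ _} ((x≢y ∷ x#) ∷ y# ∷ uniq) = λ where
    forward forward → refl
    forward backward → contradiction refl x≢y
    forward (later j) → contradiction refl (All.lookup x# (Joined⇒∈ j))
    backward forward → contradiction refl x≢y
    backward backward → refl
    backward (later j) → contradiction refl (All.lookup y# (Joined⇒∈ j))
    (later j) forward → contradiction refl (All.lookup x# (Joined⇒∈ j))
    (later j) backward → contradiction refl (All.lookup y# (Joined⇒∈ j))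
    (later j) (later j′) → Joined-functional uniq j j′

  Joined-irrefl : {es : List (A × A)} {v : A} → Unique (flat es) → ¬ Joined es v v
  Joined-irrefl {es = _ ∷ _} ((x≢x ∷ _) ∷ _) forward = x≢x refl
  Joined-irrefl {es = _ ∷ _} ((x≢x ∷ _) ∷ _) backward = x≢x refl
  Joined-irrefl {es = _ ∷ _} (_ ∷ _ ∷ uniq) (later j) = Joined-irrefl uniq j

joined? : (es : List (Fin n × Fin n)) (v w : Fin n) → Dec (Joined es v w)
joined? [] v w = no λ ()
joined? ((x , y) ∷ es) v w = map′
  (λ { (inj₁ (refl , refl)) → forward
     ; (inj₂ (inj₁ (refl , refl))) → backward
     ; (inj₂ (inj₂ j)) → later j })
  (λ { forward → inj₁ (refl , refl)
     ; backward → inj₂ (inj₁ (refl , refl))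
     ; (later j) → inj₂ (inj₂ j) })
  ((v ≟ x ×-dec w ≟ y) ⊎-dec (v ≟ y ×-dec w ≟ x) ⊎-dec joined? es v w)

does-true⇒ : {P : Set} (p? : Dec P) → does p? ≡ true → P
does-true⇒ (yes p) _ = p

-- Stated for a bare Boolean relation, so that edges can be added without maintaining the laws of a
-- `Graph`.
NearPerfect : (Fin n → Fin n → Bool) → Set
NearPerfect {n} h = ∃ λ w → ∃ λ es →
  (w ∷ flat es) ↭ allFin n × All (λ (x , y) → h x y ≡ true) es

matchingGraph : (es : List (Fin n × Fin n)) → Unique (flat es) → Graph n
matchingGraph es uniq = record
  { adj = λ v w → does (joined? es v w)
  ; sym = λ v w → does-⇔ (mk⇔ Joined-sym Joined-sym) (joined? es v w) (joined? es w v)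
  ; irrefl = λ v → dec-false (joined? es v v) (Joined-irrefl uniq)
  }

NearPerfect⇒HasPMorAPM : (H : Graph n) → NearPerfect (adj H) → HasPMorAPM H
NearPerfect⇒HasPMorAPM {n} H (w , es , covers , good) =
  M , inj₂ (M⊆H , w , unmatched , matched)
  where
  uniq : Unique (w ∷ flat es)
  uniq = Unique-resp-↭ (↭-sym covers) (allFin⁺ n)

  uniq-flat : Unique (flat es)
  uniq-flat with _ ∷ u ← uniq = u

  M : Graph n
  M = matchingGraph es uniq-flat

  Joined⇒adj : ∀ {es v x} → All (λ (x , y) → adj H x y ≡ true) es → Joined es v x → adj H v x ≡ true
  Joined⇒adj (p ∷ _) forward = p
  Joined⇒adj {v = v} {x} (p ∷ _) backward = trans (adj-sym H v x) p
  Joined⇒adj (_ ∷ ps) (later j) = Joined⇒adj ps j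

  M⊆H : M ⊆G H
  M⊆H v x m = Joined⇒adj good (does-true⇒ (joined? es v x) m)

  unmatched : deg M w ≡ 0
  unmatched = n≤0⇒n≡0 (count-≤ (adj M w) [] λ x m →
    contradiction (Joined⇒∈ (does-true⇒ (joined? es w x) m)) (Unique[x∷xs]⇒x∉xs uniq))

  matched : ∀ v → v ≢ w → deg M v ≡ 1
  matched v v≢w with ∈-resp-↭ (↭-sym covers) (∈-allFin v)
  ... | here v≡w = contradiction v≡w v≢w
  ... | there v∈ with p , j ← ∈⇒Joined es v∈ = ≤-antisym
    (count-≤ (adj M v) ([] ∷ []) λ x m →
      here (Joined-functional uniq-flat (does-true⇒ (joined? es v x) m) j))
    (count-≥ (adj M v) ([] ∷ []) λ { x (here refl) → dec-true (joined? es v p) j })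

-- Arithmetic of the final count

slack : ∀ {a b} s → a + s ≡ b → a ≤ b
slack {a} s refl = m≤m+n a s

-- Here `t` counts the triangles beyond the first. The hypothesis `1 ≤ l + r` excludes the
-- all-triangle case, where the claim would read `1 ≤ 0`. From two leaves on, the square dominates.
few-leaves-tri : ∀ l t r → 5 ≤ l + suc t + r → 1 ≤ l + r → l + 1 ≤ 2 * r + l * l + 4 * l * t
few-leaves-tri zero t (suc r) _ _ = slack (suc (2 * r)) (eq r t)
  where
  eq : ∀ r t → 1 + suc (2 * r) ≡ 2 * suc r + 0 + 4 * 0 * t
  eq = solve-∀
few-leaves-tri 1 zero (suc (suc (suc r))) _ _ = slack (5 + 2 * r) (eq r)
  where
  eq : ∀ r → 2 + (5 + 2 * r) ≡ 2 * (3 + r) + 1 + 4 * 1 * 0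
  eq = solve-∀
few-leaves-tri 1 zero 0 (s≤s (s≤s ())) _
few-leaves-tri 1 zero 1 (s≤s (s≤s (s≤s ()))) _
few-leaves-tri 1 zero 2 (s≤s (s≤s (s≤s (s≤s ())))) _
few-leaves-tri 1 (suc t) r _ _ = slack (3 + 2 * r + 4 * t) (eq t r)
  where
  eq : ∀ t r → 2 + (3 + 2 * r + 4 * t) ≡ 2 * r + 1 + 4 * 1 * suc t
  eq = solve-∀
few-leaves-tri (suc (suc l)) t r _ _ = slack (1 + 3 * l + l * l + 2 * r + 4 * (2 + l) * t) (eq l t r)
  where
  eq : ∀ l t r → (2 + l) + 1 + (1 + 3 * l + l * l + 2 * r + 4 * (2 + l) * t) ≡
    2 * r + (2 + l) * (2 + l) + 4 * (2 + l) * t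
  eq = solve-∀

-- The triangle-free case, with equality at `l = 3`, `r = 2`. For four edges it fails at
-- `l = r = 2`, which is why five matching edges, hence 13 vertices, are asked for.
few-leaves : ∀ l r → 5 ≤ l + r → 4 * l + 1 ≤ 2 * r + l * l
few-leaves zero (suc r) _ = slack (suc (2 * r)) (eq r)
  where
  eq : ∀ r → 1 + suc (2 * r) ≡ 2 * suc r + 0
  eq = solve-∀
few-leaves 1 (suc (suc (suc (suc r)))) (s≤s (s≤s (s≤s (s≤s (s≤s _))))) = slack (4 + 2 * r) (eq r)
  where
  eq : ∀ r → 5 + (4 + 2 * r) ≡ 2 * (4 + r) + 1
  eq = solve-∀
few-leaves 2 (suc (suc (suc r))) (s≤s (s≤s (s≤s (s≤s (s≤s _))))) = slack (1 + 2 * r) (eq r)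
  where
  eq : ∀ r → 9 + (1 + 2 * r) ≡ 2 * (3 + r) + 4
  eq = solve-∀
few-leaves 3 (suc (suc r)) (s≤s (s≤s (s≤s (s≤s (s≤s _))))) = slack (2 * r) (eq r)
  where
  eq : ∀ r → 13 + 2 * r ≡ 2 * (2 + r) + 9
  eq = solve-∀
few-leaves 4 (suc r) (s≤s (s≤s (s≤s (s≤s (s≤s _))))) = slack (1 + 2 * r) (eq r)
  where
  eq : ∀ r → 17 + (1 + 2 * r) ≡ 2 * (1 + r) + 16
  eq = solve-∀
few-leaves (suc (suc (suc (suc (suc l))))) r _ = slack (4 + 6 * l + l * l + 2 * r) (eq l r)
  where
  eq : ∀ l r → 4 * (5 + l) + 1 + (4 + 6 * l + l * l + 2 * r) ≡ 2 * r + (5 + l) * (5 + l)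
  eq = solve-∀

-- Doubled balance against the average of four: leaves lack `2 * l`, and the diagonal of `l * l`
-- takes another `l`; poor edges, leaf pairs and leaf-triangle pairs repay it.
few-leaves₀ : ∀ l t r → 5 ≤ l + t + r → 3 * l ≤ 2 * r + l * l + 4 * l * t
few-leaves₀ zero t r _ = z≤n
few-leaves₀ 1 zero (suc r) _ = slack (2 * r) (eq r)
  where
  eq : ∀ r → 3 + 2 * r ≡ 2 * (1 + r) + 1 + 4 * 1 * 0
  eq = solve-∀
few-leaves₀ 1 zero 0 (s≤s ())
few-leaves₀ 1 (suc t) r _ = slack (2 + 4 * t + 2 * r) (eq t r)
  where
  eq : ∀ t r → 3 + (2 + 4 * t + 2 * r) ≡ 2 * r + 1 + 4 * 1 * suc t
  eq = solve-∀
few-leaves₀ 2 zero (suc r) _ = slack (2 * r) (eq r)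
  where
  eq : ∀ r → 6 + 2 * r ≡ 2 * (1 + r) + 4 + 4 * 2 * 0
  eq = solve-∀
few-leaves₀ 2 zero 0 (s≤s (s≤s ()))
few-leaves₀ 2 (suc t) r _ = slack (6 + 8 * t + 2 * r) (eq t r)
  where
  eq : ∀ t r → 6 + (6 + 8 * t + 2 * r) ≡ 2 * r + 4 + 4 * 2 * suc t
  eq = solve-∀
few-leaves₀ (suc (suc (suc l))) t r _ = slack (3 * l + l * l + 2 * r + 4 * (3 + l) * t) (eq l t r)
  where
  eq : ∀ l t r → 3 * (3 + l) + (3 * l + l * l + 2 * r + 4 * (3 + l) * t) ≡
    2 * r + (3 + l) * (3 + l) + 4 * (3 + l) * t
  eq = solve-∀

-- l, t and r count leaves, triangles and poor edges; A, B and C bound the deleted edges at the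
-- exposed vertices, between leaves, and between leaves and triangles, and β and γ are the edges
-- absent from the outset of the last two kinds.
module _ (l t r A B C β γ : ℕ) where
  open ≤-Reasoning

  count-bound₀ : 5 ≤ l + t + r →
    3 + (3 * l + 4 * t + 5 * r) ≤ A + 0 → l * l ≤ 2 * (B + β) + l →
    l * (2 * t) ≤ C + γ → 2 * β + γ ≤ 0 →
    3 + 4 * (l + t + r) ≤ A + (B + C) + 0
  count-bound₀ many hA hB hC hν = *-cancelˡ-≤ 2 (+-cancelʳ-≤ l _ _ (begin
    2 * (3 + 4 * (l + t + r)) + l
      ≡⟨ eq₁ l t r ⟩
    2 * (3 + (3 * l + 4 * t)) + 8 * r + 3 * l
      ≤⟨ +-monoʳ-≤ (2 * (3 + (3 * l + 4 * t)) + 8 * r) (few-leaves₀ l t r many) ⟩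
    2 * (3 + (3 * l + 4 * t)) + 8 * r + (2 * r + l * l + 4 * l * t)
      ≡⟨ eq₂ l t r ⟩
    2 * (3 + (3 * l + 4 * t + 5 * r)) + l * l + 2 * (l * (2 * t))
      ≤⟨ +-mono-≤ (+-mono-≤ (*-monoʳ-≤ 2 hA) hB) (*-monoʳ-≤ 2 hC) ⟩
    2 * (A + 0) + (2 * (B + β) + l) + 2 * (C + γ)
      ≤⟨ m≤m+n _ (2 * β) ⟩
    2 * (A + 0) + (2 * (B + β) + l) + 2 * (C + γ) + 2 * β
      ≡⟨ eq₃ A B C β γ l ⟩
    2 * (A + (B + C)) + 2 * (2 * β + γ) + l
      ≤⟨ +-monoˡ-≤ l (+-monoʳ-≤ (2 * (A + (B + C))) (*-monoʳ-≤ 2 hν)) ⟩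
    2 * (A + (B + C)) + 2 * 0 + l
      ≡⟨ cong (_+ l) (sym (*-distribˡ-+ 2 (A + (B + C)) 0)) ⟩
    2 * (A + (B + C) + 0) + l ∎))
    where
    eq₁ : ∀ l t r → 2 * (3 + 4 * (l + t + r)) + l ≡ 2 * (3 + (3 * l + 4 * t)) + 8 * r + 3 * l
    eq₁ = solve-∀
    eq₂ : ∀ l t r → 2 * (3 + (3 * l + 4 * t)) + 8 * r + (2 * r + l * l + 4 * l * t) ≡
      2 * (3 + (3 * l + 4 * t + 5 * r)) + l * l + 2 * (l * (2 * t))
    eq₂ = solve-∀
    eq₃ : ∀ A B C β γ l → 2 * (A + 0) + (2 * (B + β) + l) + 2 * (C + γ) + 2 * β ≡
      2 * (A + (B + C)) + 2 * (2 * β + γ) + l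
    eq₃ = solve-∀

  count-bound₁ : 5 ≤ l + t + r → 1 ≤ l + r →
    3 + (3 * l + 4 * t + 5 * r) ≤ A + 3 → l * l ≤ 2 * (B + β) + l →
    l * (2 * t) ≤ C + γ → 2 * β + γ ≤ l →
    3 + 4 * (l + t + r) ≤ A + (B + C) + 2
  count-bound₁ many rich hA hB hC hν = finish (by-cases t many hA hC)
    where
    D = A + (B + C)
    -- The estimates are doubled because leaf pairs are counted in both orders. By parity the odd
    -- lower bound on `2 * D` rounds up to `4 * (l + t + r) + 1 ≤ D`.
    finish : 8 * (l + t + r) + 1 ≤ 2 * D → 3 + 4 * (l + t + r) ≤ D + 2
    finish 8k<2D = subst (3 + 4 * (l + t + r) ≤_) (+-comm 2 D) (s≤s (s≤s
      (*-cancelˡ-< 2 (4 * (l + t + r)) D (begin-strict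
        2 * (4 * (l + t + r)) <⟨ ≤-reflexive (eq l t r) ⟩
        8 * (l + t + r) + 1   ≤⟨ 8k<2D ⟩
        2 * D                 ∎))))
      where
      eq : ∀ l t r → suc (2 * (4 * (l + t + r))) ≡ 8 * (l + t + r) + 1
      eq = solve-∀
    by-cases : ∀ t → 5 ≤ l + t + r → 3 + (3 * l + 4 * t + 5 * r) ≤ A + 3 → l * (2 * t) ≤ C + γ →
      8 * (l + t + r) + 1 ≤ 2 * D
    -- Without triangles the bound on `C + γ` is vacuous. Leaving it out means that `hν` is spent
    -- only once, a loss of `l`, which the tight `few-leaves` can bear.
    by-cases zero many hA _ = +-cancelʳ-≤ (6 + l + l) _ _ (begin
      8 * (l + 0 + r) + 1 + (6 + l + l)
        ≡⟨ eq₁ l r ⟩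
      6 + 6 * l + 8 * r + (4 * l + 1) + 0
        ≤⟨ +-mono-≤ (+-monoʳ-≤ (6 + 6 * l + 8 * r) (few-leaves l r many′)) z≤n ⟩
      6 + 6 * l + 8 * r + (2 * r + l * l) + (2 * C + γ)
        ≡⟨ eq₂ l r C γ ⟩
      2 * (3 + (3 * l + 4 * 0 + 5 * r)) + l * l + (2 * C + γ)
        ≤⟨ +-monoˡ-≤ (2 * C + γ) (+-mono-≤ (*-monoʳ-≤ 2 hA) hB) ⟩
      2 * (A + 3) + (2 * (B + β) + l) + (2 * C + γ)
        ≡⟨ eq₃ A B C β γ l ⟩
      2 * D + 6 + l + (2 * β + γ)
        ≤⟨ +-monoʳ-≤ (2 * D + 6 + l) hν ⟩
      2 * D + 6 + l + l
        ≡⟨ eq₄ D l ⟩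
      2 * D + (6 + l + l) ∎)
      where
      many′ : 5 ≤ l + r
      many′ = subst (λ s → 5 ≤ s + r) (+-identityʳ l) many
      eq₁ : ∀ l r → 8 * (l + 0 + r) + 1 + (6 + l + l) ≡ 6 + 6 * l + 8 * r + (4 * l + 1) + 0
      eq₁ = solve-∀
      eq₂ : ∀ l r C γ → 6 + 6 * l + 8 * r + (2 * r + l * l) + (2 * C + γ) ≡
        2 * (3 + (3 * l + 4 * 0 + 5 * r)) + l * l + (2 * C + γ)
      eq₂ = solve-∀
      eq₃ : ∀ A B C β γ l → 2 * (A + 3) + (2 * (B + β) + l) + (2 * C + γ) ≡
        2 * (A + (B + C)) + 6 + l + (2 * β + γ)
      eq₃ = solve-∀
      eq₄ : ∀ D l → 2 * D + 6 + l + l ≡ 2 * D + (6 + l + l)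
      eq₄ = solve-∀
    -- Now `hC` enters doubled and `hν` is spent twice; the `4 * l` contributed by the first
    -- triangle outweighs the extra loss of `l`.
    by-cases (suc t) many hA hC = +-cancelʳ-≤ (6 + l + (l + l)) _ _ (begin
      8 * (l + suc t + r) + 1 + (6 + l + (l + l))
        ≡⟨ eq₁ l t r ⟩
      6 + 10 * l + 8 * suc t + 8 * r + (l + 1)
        ≤⟨ +-monoʳ-≤ (6 + 10 * l + 8 * suc t + 8 * r) (few-leaves-tri l t r many rich) ⟩
      6 + 10 * l + 8 * suc t + 8 * r + (2 * r + l * l + 4 * l * t)
        ≡⟨ eq₂ l t r ⟩
      2 * (3 + (3 * l + 4 * suc t + 5 * r)) + l * l + 2 * (l * (2 * suc t))
        ≤⟨ +-mono-≤ (+-mono-≤ (*-monoʳ-≤ 2 hA) hB) (*-monoʳ-≤ 2 hC) ⟩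
      2 * (A + 3) + (2 * (B + β) + l) + 2 * (C + γ)
        ≤⟨ m≤m+n _ (2 * β) ⟩
      2 * (A + 3) + (2 * (B + β) + l) + 2 * (C + γ) + 2 * β
        ≡⟨ eq₃ A B C β γ l ⟩
      2 * D + 6 + l + ((2 * β + γ) + (2 * β + γ))
        ≤⟨ +-monoʳ-≤ (2 * D + 6 + l) (+-mono-≤ hν hν) ⟩
      2 * D + 6 + l + (l + l)
        ≡⟨ eq₄ D l ⟩
      2 * D + (6 + l + (l + l)) ∎)
      where
      eq₁ : ∀ l t r → 8 * (l + suc t + r) + 1 + (6 + l + (l + l)) ≡
        6 + 10 * l + 8 * suc t + 8 * r + (l + 1)
      eq₁ = solve-∀
      eq₂ : ∀ l t r → 6 + 10 * l + 8 * suc t + 8 * r + (2 * r + l * l + 4 * l * t) ≡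
        2 * (3 + (3 * l + 4 * suc t + 5 * r)) + l * l + 2 * (l * (2 * suc t))
      eq₂ = solve-∀
      eq₃ : ∀ A B C β γ l → 2 * (A + 3) + (2 * (B + β) + l) + 2 * (C + γ) + 2 * β ≡
        2 * (A + (B + C)) + 6 + l + ((2 * β + γ) + (2 * β + γ))
      eq₃ = solve-∀
      eq₄ : ∀ D l → 2 * D + 6 + l + (l + l) ≡ 2 * D + (6 + l + (l + l))
      eq₄ = solve-∀

-- Matchings without short augmenting paths

module _ {A : Set} where
  open CommutativeMonoidSolver (++-commutativeMonoid {A = A})

  -- After augmenting along a - x - y - b the vertices are the same up to order and only `c` is
  -- exposed. `augment₂-↭` does this for paths through two matching edges.
  augment₁-↭ : (a b c x y : A) (F : List A) →
    c ∷ a ∷ x ∷ b ∷ y ∷ F ↭ (a ∷ b ∷ c ∷ []) ++ x ∷ y ∷ F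
  augment₁-↭ a b c x y F = solve 6
    (λ a b c x y F → c ⊕ a ⊕ x ⊕ b ⊕ y ⊕ F ⊜ (a ⊕ b ⊕ c ⊕ id) ⊕ x ⊕ y ⊕ F) ↭-refl
    (a ∷ []) (b ∷ []) (c ∷ []) (x ∷ []) (y ∷ []) F

  augment₂-↭ : (a b c x y x′ y′ : A) (F : List A) →
    c ∷ a ∷ x ∷ y ∷ y′ ∷ b ∷ x′ ∷ F ↭ (a ∷ b ∷ c ∷ []) ++ (x ∷ y ∷ []) ++ (x′ ∷ y′ ∷ []) ++ F
  augment₂-↭ a b c x y x′ y′ F = solve 8
    (λ a b c x y x′ y′ F → c ⊕ a ⊕ x ⊕ y ⊕ y′ ⊕ b ⊕ x′ ⊕ F ⊜
      (a ⊕ b ⊕ c ⊕ id) ⊕ (x ⊕ y ⊕ id) ⊕ (x′ ⊕ y′ ⊕ id) ⊕ F) ↭-refl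
    (a ∷ []) (b ∷ []) (c ∷ []) (x ∷ []) (y ∷ []) (x′ ∷ []) (y′ ∷ []) F

-- An augmenting path uses two of the exposed vertices; the remaining one becomes the vertex that an
-- almost-perfect matching misses.
third : (u : Fin 3 → A) {i j : Fin 3} → i ≢ j → ∃ λ k → u i ∷ u j ∷ u k ∷ [] ↭ tabulate u
third u {0F} {0F} i≢j = contradiction refl i≢j
third u {0F} {1F} _ = 2F , ↭-refl
third u {0F} {2F} _ = 1F , prep _ (swap _ _ ↭-refl)
third u {1F} {0F} _ = 2F , swap _ _ ↭-refl
third u {1F} {1F} i≢j = contradiction refl i≢j
third u {1F} {2F} _ = 0F , ↭-sym (↭-trans (swap _ _ ↭-refl) (prep _ (swap _ _ ↭-refl)))
third u {2F} {0F} _ = 1F , ↭-trans (swap _ _ ↭-refl) (prep _ (swap _ _ ↭-refl))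
third u {2F} {1F} _ = 0F , ↭-trans (prep _ (swap _ _ ↭-refl))
  (↭-trans (swap _ _ ↭-refl) (prep _ (swap _ _ ↭-refl)))
third u {2F} {2F} i≢j = contradiction refl i≢j

module NoAugmentation {n} (h : Fin n → Fin n → Bool) (¬np : ¬ NearPerfect h)
  (u : Fin 3 → Fin n) where

  Matching : List (Fin n × Fin n) → Set
  Matching es = (tabulate u ++ flat es) ↭ allFin n × All (λ (x , y) → h x y ≡ true) es

  Matching-resp-↭ : ∀ {es fs} → es ↭ fs → Matching es → Matching fs
  Matching-resp-↭ p (covers , good) =
    ↭-trans (++⁺ˡ (tabulate u) (↭-sym (flat-↭ p))) covers , All-resp-↭ p good

  -- An edge between two exposed vertices is already an augmenting path, containing no matching
  -- edge.
  unmatched-nonadjacent : ∀ {es i j} → Matching es → i ≢ j → h (u i) (u j) ≡ false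
  unmatched-nonadjacent {es} (covers , good) i≢j = not-≢true λ uᵢ~uⱼ →
    let k , p = third u i≢j in
    ¬np (u k , _ , ↭-trans (↭-trans (shift-last _ _ _) (++⁺ʳ (flat es) p)) covers , uᵢ~uⱼ ∷ good)
    where
    shift-last : ∀ (a b c : Fin n) {F} → c ∷ a ∷ b ∷ F ↭ a ∷ b ∷ c ∷ F
    shift-last a b c = ↭-sym (shift c (a ∷ b ∷ []) _)

  -- The augmenting path u i – x – y – u j.
  no-augment₁ : ∀ {x y es i j} → Matching ((x , y) ∷ es) → i ≢ j →
    h (u i) x ≡ true → h (u j) y ≡ false
  no-augment₁ {x} {y} {es} {i} {j} (covers , _ ∷ good) i≢j uᵢ~x = not-≢true λ uⱼ~y →
    let k , p = third u i≢j in
    ¬np (u k , (u i , x) ∷ (u j , y) ∷ es ,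
      ↭-trans (augment₁-↭ (u i) (u j) (u k) x y (flat es)) (↭-trans (++⁺ʳ _ p) covers) ,
      uᵢ~x ∷ uⱼ~y ∷ good)

  -- The augmenting path u i – x – y – y′ – x′ – u j.
  no-augment₂ : ∀ {e e′ x y x′ y′ es i j} → Matching (e ∷ e′ ∷ es) →
    x ∷ y ∷ [] ↭ flat (e ∷ []) → x′ ∷ y′ ∷ [] ↭ flat (e′ ∷ []) → i ≢ j →
    h (u i) x ≡ true → h (u j) x′ ≡ true → h y y′ ≡ false
  no-augment₂ {e} {e′} {x} {y} {x′} {y′} {es} {i} {j}
    (covers , _ ∷ _ ∷ good) xy x′y′ i≢j uᵢ~x uⱼ~x′ = not-≢true λ y~y′ →
    let k , p = third u i≢j in
    ¬np (u k , (u i , x) ∷ (y , y′) ∷ (u j , x′) ∷ es ,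
      ↭-trans (augment₂-↭ (u i) (u j) (u k) x y x′ y′ (flat es))
        (↭-trans (++⁺ p (++⁺ xy (++⁺ʳ (flat es) x′y′))) covers) ,
      uᵢ~x ∷ y~y′ ∷ uⱼ~x′ ∷ good)

  deficit : Fin n → ℕ
  deficit v = ∑ (λ w → [ not (h w v) ]) (tabulate u)

  -- The pair is oriented: the second end sees no exposed vertex. Two exposed neighbours of the
  -- first end are recorded so that one remains available when the other is needed at the far end of
  -- an augmenting path.
  Leaf : Fin n × Fin n → Set
  Leaf (x , y) = (∀ i → h (u i) y ≡ false) ×
    ∃ λ i → ∃ λ j → i ≢ j × h (u i) x ≡ true × h (u j) x ≡ true

  OnlyAt : Fin 3 → Fin n → Set
  OnlyAt i v = h (u i) v ≡ true × (∀ j → i ≢ j → h (u j) v ≡ false)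

  Triangle : Fin 3 → Fin n × Fin n → Set
  Triangle i (x , y) = OnlyAt i x × OnlyAt i y

  Poor : Fin n × Fin n → Set
  Poor (x , y) = 5 ≤ deficit x + deficit y

  deficit-none : ∀ {v} → (∀ i → h (u i) v ≡ false) → deficit v ≡ 3
  deficit-none {v} none rewrite none 0F | none 1F | none 2F = refl

  deficit-only : ∀ {v} i → (∀ j → i ≢ j → h (u j) v ≡ false) → 2 ≤ deficit v
  deficit-only 0F only rewrite only 1F (λ ()) | only 2F (λ ()) = m≤n+m 2 _
  deficit-only 1F only rewrite only 0F (λ ()) | only 2F (λ ()) = s≤s (m≤n+m 1 _)
  deficit-only 2F only rewrite only 0F (λ ()) | only 1F (λ ()) = s≤s (s≤s z≤n)

  neighbours : ∀ v →
    (∃ λ i → ∃ λ j → i ≢ j × h (u i) v ≡ true × h (u j) v ≡ true) ⊎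
    (∃ λ i → OnlyAt i v) ⊎ (∀ i → h (u i) v ≡ false)
  neighbours v with any? (λ i → h (u i) v Bool.≟ true)
  ... | no none = inj₂ (inj₂ λ i → not-≢true λ t → none (i , t))
  ... | yes (i , uᵢ~v) with any? (λ j → ¬? (i ≟ j) ×-dec (h (u j) v Bool.≟ true))
  ...   | yes (j , i≢j , uⱼ~v) = inj₁ (i , j , i≢j , uᵢ~v , uⱼ~v)
  ...   | no only = inj₂ (inj₁ (i , uᵢ~v , λ j i≢j → not-≢true λ t → only (j , i≢j , t)))

  Class : Fin n × Fin n → Set
  Class (x , y) = Leaf (x , y) ⊎ Leaf (y , x) ⊎ (∃ λ i → Triangle i (x , y)) ⊎ Poor (x , y)

  -- If one end sees two exposed vertices, every exposed vertex differs from one of them, so the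
  -- other end sees none: a leaf. If both ends see exactly one, it is the same one: a triangle.
  -- Otherwise some end sees none and the other at most one, so at least 3 + 2 edges are missing.
  classify : ∀ x y → (∀ {i j} → i ≢ j → h (u i) x ≡ true → h (u j) y ≡ false) → Class (x , y)
  classify x y free with neighbours x | neighbours y
  ... | inj₁ (i , j , i≢j , uᵢ~x , uⱼ~x) | _ = inj₁ (none , i , j , i≢j , uᵢ~x , uⱼ~x)
    where
    none : ∀ k → h (u k) y ≡ false
    none k with i ≟ k
    ... | yes refl = free (i≢j ∘ sym) uⱼ~x
    ... | no i≢k = free i≢k uᵢ~x
  ... | _ | inj₁ (i , j , i≢j , uᵢ~y , uⱼ~y) = inj₂ (inj₁ (none , i , j , i≢j , uᵢ~y , uⱼ~y))
    where
    none : ∀ k → h (u k) x ≡ false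
    none k with k ≟ i
    ... | yes refl = not-≢true λ t → contradiction (trans (sym uⱼ~y) (free i≢j t)) λ ()
    ... | no k≢i = not-≢true λ t → contradiction (trans (sym uᵢ~y) (free k≢i t)) λ ()
  ... | inj₂ (inj₁ (i , x₁)) | inj₂ (inj₁ (j , y₁)) with i ≟ j
  ...   | yes refl = inj₂ (inj₂ (inj₁ (i , x₁ , y₁)))
  ...   | no i≢j = contradiction (trans (sym (proj₁ y₁)) (free i≢j (proj₁ x₁))) λ ()
  classify x y free | inj₂ (inj₁ (i , _ , only)) | inj₂ (inj₂ none) = inj₂ (inj₂ (inj₂
    (+-mono-≤ (deficit-only i only) (≤-reflexive (sym (deficit-none none))))))
  classify x y free | inj₂ (inj₂ none) | inj₂ (inj₁ (i , _ , only)) = inj₂ (inj₂ (inj₂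
    (+-mono-≤ (≤-reflexive (sym (deficit-none none))) (deficit-only i only))))
  classify x y free | inj₂ (inj₂ none) | inj₂ (inj₂ none′) = inj₂ (inj₂ (inj₂
    (≤-trans (n≤1+n 5) (+-mono-≤ (≤-reflexive (sym (deficit-none none)))
      (≤-reflexive (sym (deficit-none none′)))))))

  -- Only the vertex lists are required to agree, not the edge lists, because a leaf may have to be
  -- reversed to fit its orientation.
  record Classified (es : List (Fin n × Fin n)) : Set where
    constructor classified
    field
      {leaves triangles poor} : List (Fin n × Fin n)
      same-vertices : flat (leaves ++ triangles ++ poor) ↭ flat es
      good : All (λ (x , y) → h x y ≡ true) (leaves ++ triangles ++ poor)
      are-leaves : All Leaf leaves
      are-triangles : All (λ e → ∃ λ i → Triangle i e) triangles
      are-poor : All Poor poor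

  partition : (∀ x y → h x y ≡ h y x) → ∀ {es} →
    All (λ (x , y) → h x y ≡ true) es → All Class es → Classified es
  partition h-sym [] [] = classified ↭-refl [] [] [] []
  partition h-sym {e ∷ _} (g ∷ gs) (c ∷ cs)
    with classified {ls} {ts} {ps} same good are-l are-t are-p ← partition h-sym gs cs
    with c
  ... | inj₁ leaf = classified (prep _ (prep _ same)) (g ∷ good) (leaf ∷ are-l) are-t are-p
  ... | inj₂ (inj₁ leaf) = classified (swap _ _ same) (trans (h-sym _ _) g ∷ good) (leaf ∷ are-l) are-t are-p
  ... | inj₂ (inj₂ (inj₁ tri)) = classified
    (↭-trans (flat-↭ (shift e ls (ts ++ ps))) (prep _ (prep _ same)))
    (All-resp-↭ (↭-sym (shift e ls (ts ++ ps))) (g ∷ good)) are-l (tri ∷ are-t) are-p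
  ... | inj₂ (inj₂ (inj₂ poor)) = classified
    (↭-trans (flat-↭ moved) (prep _ (prep _ same)))
    (All-resp-↭ (↭-sym moved) (g ∷ good)) are-l are-t (poor ∷ are-p)
    where
    moved : ls ++ ts ++ e ∷ ps ↭ e ∷ ls ++ ts ++ ps
    moved = ↭-trans (++⁺ˡ ls (shift e ts ps)) (shift e ls (ts ++ ps))

-- Counting missing edges

-- Every missing edge is charged to d (edges deleted, to be counted) or to ν (edges absent from
-- the outset, at most c at each vertex).  The diagonal of ν absorbs the extra 1 in ν-row, so that
-- no distinctness of vertices has to be tracked.
record Weights (n c : ℕ) : Set where
  field
    d ν : Fin n → Fin n → ℕ
    d-sym : ∀ v w → d v w ≡ d w v
    ν-sym : ∀ v w → ν v w ≡ ν w v
    ν-diagonal : ∀ v → 1 ≤ ν v v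
    ν-row : ∀ v → ∑ (ν v) (allFin n) ≤ suc c

module _ {n c} (W : Weights n c) where
  open Weights W

  -- Sum the rows of the vertices in `Z`: pairs inside `Z` are met twice, and each diagonal entry
  -- uses up the extra 1 of its row.
  ν-incident : ∀ Z X {R} → allFin n ↭ Z ++ X ++ R → 2 * pairSum ν Z + cross ν Z X ≤ length Z * c
  ν-incident Z X {R} allFin↭ = +-cancelʳ-≤ (length Z) _ _ (begin
    2 * pairSum ν Z + cross ν Z X + length Z
      ≡⟨ cong (2 * pairSum ν Z + cross ν Z X +_) (*-identityʳ (length Z)) ⟨
    2 * pairSum ν Z + cross ν Z X + length Z * 1
      ≤⟨ +-monoʳ-≤ _ (∑-≥ 1 Z λ v _ → ν-diagonal v) ⟩
    2 * pairSum ν Z + cross ν Z X + ∑ (λ v → ν v v) Z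
      ≡⟨ rearrange (pairSum ν Z) (cross ν Z X) (∑ (λ v → ν v v) Z) ⟩
    2 * pairSum ν Z + ∑ (λ v → ν v v) Z + cross ν Z X
      ≡⟨ cong (_+ cross ν Z X) (cross-diagonal ν ν-sym Z) ⟨
    cross ν Z Z + cross ν Z X
      ≤⟨ +-monoʳ-≤ (cross ν Z Z) (m≤m+n _ _) ⟩
    cross ν Z Z + (cross ν Z X + cross ν Z R)
      ≡⟨ cong (cross ν Z Z +_) (cross-++ʳ ν Z X R) ⟨
    cross ν Z Z + cross ν Z (X ++ R)
      ≡⟨ cross-++ʳ ν Z Z (X ++ R) ⟨
    cross ν Z (Z ++ X ++ R)
      ≡⟨ ∑-cong (λ v → ∑-↭ (ν v) allFin↭) Z ⟨
    cross ν Z (allFin n)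
      ≤⟨ ∑-≤ (suc c) Z (λ v _ → ν-row v) ⟩
    length Z * suc c
      ≡⟨ trans (*-suc (length Z) c) (+-comm (length Z) _) ⟩
    length Z * c + length Z ∎)
    where
    open ≤-Reasoning
    rearrange : ∀ a b s → 2 * a + b + s ≡ 2 * a + s + b
    rearrange = solve-∀

  -- Only non-adjacent pairs have to be paid for, so the condition survives the addition of edges to
  -- `h`.
  Covers : (Fin n → Fin n → Bool) → Set
  Covers h = ∀ v w → h v w ≡ false → 1 ≤ d v w + ν v w

  d-incident : ∀ {h} → Covers h → ∀ Z X {R} → allFin n ↭ Z ++ X ++ R →
    pairSum (λ v w → [ not (h v w) ]) Z + cross (λ v w → [ not (h v w) ]) Z X ≤
    pairSum d Z + cross d Z X + length Z * c
  d-incident {h} covers Z X {R} allFin↭ = begin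
    pairSum m Z + cross m Z X
      ≤⟨ +-mono-≤ (pairSum-mono m≤d+ν Z) (cross-mono m≤d+ν Z X) ⟩
    pairSum (λ v w → d v w + ν v w) Z + cross (λ v w → d v w + ν v w) Z X
      ≡⟨ cong₂ _+_ (pairSum-distrib-+ d ν Z) (cross-distrib-+ d ν Z X) ⟩
    (pairSum d Z + pairSum ν Z) + (cross d Z X + cross ν Z X)
      ≤⟨ m≤m+n _ (pairSum ν Z) ⟩
    (pairSum d Z + pairSum ν Z) + (cross d Z X + cross ν Z X) + pairSum ν Z
      ≡⟨ rearrange (pairSum d Z) (pairSum ν Z) (cross d Z X) (cross ν Z X) ⟩
    pairSum d Z + cross d Z X + (2 * pairSum ν Z + cross ν Z X)
      ≤⟨ +-monoʳ-≤ (pairSum d Z + cross d Z X) (ν-incident Z X allFin↭) ⟩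
    pairSum d Z + cross d Z X + length Z * c ∎
    where
    open ≤-Reasoning
    m = λ v w → [ not (h v w) ]
    m≤d+ν : ∀ v w → m v w ≤ d v w + ν v w
    m≤d+ν v w with h v w in eq
    ... | true = z≤n
    ... | false = covers v w eq
    rearrange : ∀ a b e f → (a + b) + (e + f) + b ≡ a + e + (2 * b + f)
    rearrange = solve-∀

  pairSum-incident : ∀ Z X {R} {L} → L ↭ Z ++ X ++ R → pairSum d Z + cross d Z X ≤ pairSum d L
  pairSum-incident Z X {R} {L} L↭ = begin
    pairSum d Z + cross d Z X
      ≤⟨ +-monoʳ-≤ (pairSum d Z) (m≤m+n _ _) ⟩
    pairSum d Z + (cross d Z X + cross d Z R)
      ≡⟨ cong (pairSum d Z +_) (cross-++ʳ d Z X R) ⟨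
    pairSum d Z + cross d Z (X ++ R)
      ≤⟨ m≤m+n _ _ ⟩
    pairSum d Z + cross d Z (X ++ R) + pairSum d (X ++ R)
      ≡⟨ pairSum-++ d Z (X ++ R) ⟨
    pairSum d (Z ++ X ++ R)
      ≡⟨ pairSum-↭ d d-sym L↭ ⟨
    pairSum d L ∎
    where open ≤-Reasoning

-- Lower bound on the deleted edges when three vertices are exposed

module CountMissing {n c} (W : Weights n c) (c≤1 : c ≤ 1)
  (h : Fin n → Fin n → Bool) (covers : Covers W h) (¬np : ¬ NearPerfect h)
  (u : Fin 3 → Fin n) where

  open Weights W
  open NoAugmentation h ¬np u

  U = tabulate u
  m : Fin n → Fin n → ℕ
  m v w = [ not (h v w) ]

  cost : Fin n × Fin n → ℕ
  cost (x , y) = deficit x + deficit y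

  -- The 3 on the left is the three missing pairs inside `U`; the `3 * c` on the right is the
  -- allowance of the three vertices of `U`.
  costs-≤ : ∀ {es} → Matching es → 3 + ∑ cost es ≤ pairSum d U + cross d U (flat es) + 3 * c
  costs-≤ {es} M@(vertices , _) = begin
    3 + ∑ cost es
      ≤⟨ +-mono-≤ pairs (≤-reflexive (trans (sym (∑-flat deficit es)) (sym (∑-swap m U (flat es))))) ⟩
    pairSum m U + cross m U (flat es)
      ≤⟨ d-incident W covers U (flat es)
           (↭-trans (↭-sym vertices) (++⁺ˡ U (↭-sym (++-identityʳ (flat es))))) ⟩
    pairSum d U + cross d U (flat es) + 3 * c ∎
    where
    open ≤-Reasoning
    pairs : 3 ≤ pairSum m U
    pairs rewrite unmatched-nonadjacent {i = 0F} {1F} M (λ ())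
                | unmatched-nonadjacent {i = 0F} {2F} M (λ ())
                | unmatched-nonadjacent {i = 1F} {2F} M (λ ()) = ≤-refl

  leaf-cost : ∀ {e} → Leaf e → 3 ≤ cost e
  leaf-cost {x , y} (none , _) = ≤-trans (≤-reflexive (sym (deficit-none none))) (m≤n+m _ (deficit x))

  triangle-cost : ∀ {i e} → Triangle i e → 4 ≤ cost e
  triangle-cost {i} ((_ , x-only) , (_ , y-only)) = +-mono-≤ (deficit-only i x-only) (deficit-only i y-only)

  -- Both first ends see two exposed vertices, so distinct ones can be chosen; an edge between the
  -- second ends would then complete an augmenting path.
  leaves-nonadjacent : ∀ {e e′ es} → Matching (e ∷ e′ ∷ es) → Leaf e → Leaf e′ →
    h (proj₂ e) (proj₂ e′) ≡ false
  leaves-nonadjacent M (_ , i , j , i≢j , uᵢ~x , uⱼ~x) (_ , i′ , j′ , i′≢j′ , uᵢ′~x′ , uⱼ′~x′)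
    with i ≟ i′
  ... | yes refl = no-augment₂ M ↭-refl ↭-refl i′≢j′ uᵢ~x uⱼ′~x′
  ... | no i≢i′ = no-augment₂ M ↭-refl ↭-refl i≢i′ uᵢ~x uᵢ′~x′

  -- One of the leaf's two exposed neighbours differs from the apex `u k`. The augmenting path would
  -- enter the triangle at `v` and leave through its other end to the apex.
  leaf-triangle-nonadjacent : ∀ {e e′ es k v} → Matching (e ∷ e′ ∷ es) → Leaf e → Triangle k e′ →
    v ≡ proj₁ e′ ⊎ v ≡ proj₂ e′ → h (proj₂ e) v ≡ false
  leaf-triangle-nonadjacent {k = k} M (_ , i , j , i≢j , uᵢ~x , uⱼ~x) ((u~x′ , _) , (u~y′ , _)) v∈e′
    with i ≟ k | v∈e′
  ... | yes refl | inj₁ refl = no-augment₂ M ↭-refl (swap _ _ ↭-refl) (i≢j ∘ sym) uⱼ~x u~y′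
  ... | yes refl | inj₂ refl = no-augment₂ M ↭-refl ↭-refl (i≢j ∘ sym) uⱼ~x u~x′
  ... | no i≢k | inj₁ refl = no-augment₂ M ↭-refl (swap _ _ ↭-refl) i≢k uᵢ~x u~y′
  ... | no i≢k | inj₂ refl = no-augment₂ M ↭-refl ↭-refl i≢k uᵢ~x u~x′

  triangles-nonadjacent : ∀ {e e′ es i j v w} → Matching (e ∷ e′ ∷ es) → i ≢ j →
    Triangle i e → Triangle j e′ → v ∈ flat (e ∷ []) → w ∈ flat (e′ ∷ []) → h v w ≡ false
  triangles-nonadjacent M i≢j ((u~x , _) , (u~y , _)) ((u~x′ , _) , (u~y′ , _)) = λ where
    (here refl) (here refl) → no-augment₂ M (swap _ _ ↭-refl) (swap _ _ ↭-refl) i≢j u~y u~y′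
    (here refl) (there (here refl)) → no-augment₂ M (swap _ _ ↭-refl) ↭-refl i≢j u~y u~x′
    (there (here refl)) (here refl) → no-augment₂ M ↭-refl (swap _ _ ↭-refl) i≢j u~x u~y′
    (there (here refl)) (there (here refl)) → no-augment₂ M ↭-refl ↭-refl i≢j u~x u~x′

  total : ∀ {es} → Matching es →
    pairSum d (allFin n) ≡ pairSum d U + cross d U (flat es) + pairSum d (flat es)
  total {es} (vertices , _) = trans (pairSum-↭ d d-sym (↭-sym vertices)) (pairSum-++ d U (flat es))

  module _ {ls ts ps} (M : Matching (ls ++ ts ++ ps)) (are-leaves : All Leaf ls)
    (are-triangles : All (λ e → ∃ λ i → Triangle i e) ts) (are-poor : All Poor ps) where

    private
      l = length ls
      t = length ts
      p = length ps
      es = ls ++ ts ++ ps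
      Y = map proj₂ ls

    costs-≥ : 3 * l + 4 * t + 5 * p ≤ ∑ cost es
    costs-≥ = begin
      3 * l + 4 * t + 5 * p
        ≡⟨ cong₂ _+_ (cong₂ _+_ (*-comm 3 l) (*-comm 4 t)) (*-comm 5 p) ⟩
      l * 3 + t * 4 + p * 5
        ≤⟨ +-mono-≤ (+-mono-≤ (∑-≥ 3 ls λ _ → leaf-cost ∘ All.lookup are-leaves)
             (∑-≥ 4 ts λ _ → triangle-cost ∘ proj₂ ∘ All.lookup are-triangles))
             (∑-≥ 5 ps λ _ → All.lookup are-poor) ⟩
      ∑ cost ls + ∑ cost ts + ∑ cost ps
        ≡⟨ +-assoc (∑ cost ls) (∑ cost ts) (∑ cost ps) ⟩
      ∑ cost ls + (∑ cost ts + ∑ cost ps)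
        ≡⟨ cong (∑ cost ls +_) (∑-++ cost ts ps) ⟨
      ∑ cost ls + ∑ cost (ts ++ ps)
        ≡⟨ ∑-++ cost ls (ts ++ ps) ⟨
      ∑ cost es ∎
      where open ≤-Reasoning

    leaf-pairs : l * l ≤ 2 * (pairSum d Y + pairSum ν Y) + l
    leaf-pairs = subst (λ s → l * l ≤ 2 * s + l)
      (trans (sym (pairSum-map _ proj₂ ls)) (pairSum-distrib-+ d ν Y))
      (pairSum-≥ _ ls λ e e′ rest ls↭ → covers _ _
        (leaves-nonadjacent (Matching-resp-↭ (++⁺ʳ (ts ++ ps) ls↭) M)
          (All.lookup are-leaves (∈-resp-↭ (↭-sym ls↭) (here refl)))
          (All.lookup are-leaves (∈-resp-↭ (↭-sym ls↭) (there (here refl))))))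

    leaf-triangle-pairs : l * (2 * t) ≤ cross d Y (flat ts) + cross ν Y (flat ts)
    leaf-triangle-pairs = subst₂ _≤_
      (cong₂ _*_ (length-map proj₂ ls) (trans (*-identityʳ _) (length-flat ts)))
      (cross-distrib-+ d ν Y (flat ts))
      (cross-≥ 1 Y (flat ts) nonadjacent)
      where
      nonadjacent : ∀ y v → y ∈ Y → v ∈ flat ts → 1 ≤ d y v + ν y v
      nonadjacent y v y∈ v∈ with ∈-map⁻ proj₂ y∈ | ∈-flat⁻ ts v∈
      ... | e , e∈ , refl | e′ , e′∈ , v∈e′ with ∈⇒↭ e∈ | ∈⇒↭ e′∈
      ...   | ls′ , ls↭ | ts′ , ts↭ = covers y v (leaf-triangle-nonadjacent
        (Matching-resp-↭ (↭-trans (++⁺ ls↭ (++⁺ʳ ps ts↭)) (prep e (shift e′ ls′ (ts′ ++ ps)))) M)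
        (All.lookup are-leaves e∈) (proj₂ (All.lookup are-triangles e′∈)) v∈e′)

    flat-↭-leaf-ends : flat es ↭ Y ++ flat ts ++ (map proj₁ ls ++ flat ps)
    flat-↭-leaf-ends = begin
      flat (ls ++ ts ++ ps)                     ≡⟨ flat-++ ls (ts ++ ps) ⟩
      flat ls ++ flat (ts ++ ps)                ≡⟨ cong (flat ls ++_) (flat-++ ts ps) ⟩
      flat ls ++ (flat ts ++ flat ps)           ↭⟨ ++⁺ʳ _ (flat-split ls) ⟩
      (Y ++ map proj₁ ls) ++ (flat ts ++ flat ps) ↭⟨ ++-assoc Y (map proj₁ ls) _ ⟩
      Y ++ (map proj₁ ls ++ (flat ts ++ flat ps)) ↭⟨ ++⁺ˡ Y (shifts (map proj₁ ls) (flat ts)) ⟩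
      Y ++ (flat ts ++ (map proj₁ ls ++ flat ps)) ∎
      where open PermutationReasoning

    -- Three disjoint families of pairs are counted: those meeting `U`, those between two leaf ends
    -- in `Y`, and those between `Y` and triangles. The allowance `c` is granted once at each vertex
    -- of `U` and once at each vertex of `Y`.
    mixed-bound : 5 ≤ length es → 1 ≤ l + p → 3 + 4 * length es ≤ pairSum d (allFin n) + 2 * c
    mixed-bound many some = begin
      3 + 4 * length es
        ≡⟨ cong (λ s → 3 + 4 * s) lengths ⟩
      3 + 4 * (l + t + p)
        ≤⟨ bound c c≤1 (≤-trans (+-monoʳ-≤ 3 costs-≥) (costs-≤ M)) ν-bound ⟩
      S + (T + V) + 2 * c
        ≤⟨ +-monoˡ-≤ (2 * c) (+-monoʳ-≤ S (pairSum-incident W Y (flat ts) flat-↭-leaf-ends)) ⟩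
      S + pairSum d (flat es) + 2 * c
        ≡⟨ cong (_+ 2 * c) (total M) ⟨
      pairSum d (allFin n) + 2 * c ∎
      where
      open ≤-Reasoning
      lengths : length es ≡ l + t + p
      lengths = trans (length-++ ls) (trans (cong (l +_) (length-++ ts)) (sym (+-assoc l t p)))
      many′ = subst (5 ≤_) lengths many
      S = pairSum d U + cross d U (flat es)
      T = pairSum d Y
      V = cross d Y (flat ts)
      ν-bound : 2 * pairSum ν Y + cross ν Y (flat ts) ≤ l * c
      ν-bound = subst (λ s → 2 * pairSum ν Y + cross ν Y (flat ts) ≤ s * c) (length-map proj₂ ls)
        (ν-incident W Y (flat ts) (↭-trans (↭-sym (proj₁ M)) (↭-trans (++-comm U (flat es))
          (↭-trans (++⁺ʳ U flat-↭-leaf-ends) (↭-trans (++-assoc Y _ U) (++⁺ˡ Y (++-assoc (flat ts) _ U)))))))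
      bound : ∀ c → c ≤ 1 → 3 + (3 * l + 4 * t + 5 * p) ≤ S + 3 * c →
        2 * pairSum ν Y + cross ν Y (flat ts) ≤ l * c → 3 + 4 * (l + t + p) ≤ S + (T + V) + 2 * c
      bound 0 _ hA hν = count-bound₀ l t p S T V (pairSum ν Y) (cross ν Y (flat ts))
        many′ hA leaf-pairs leaf-triangle-pairs (≤-trans hν (≤-reflexive (*-zeroʳ l)))
      bound 1 _ hA hν = count-bound₁ l t p S T V (pairSum ν Y) (cross ν Y (flat ts))
        many′ some hA leaf-pairs leaf-triangle-pairs (≤-trans hν (≤-reflexive (*-identityʳ l)))
      bound (suc (suc _)) (s≤s ())

  other-two : ∀ i → ∃ λ j → ∃ λ k → i ≢ j × i ≢ k × j ≢ k × u j ∷ u k ∷ u i ∷ [] ↭ U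
  other-two 0F = 1F , 2F , (λ ()) , (λ ()) , (λ ()) , shift (u 0F) (u 1F ∷ u 2F ∷ []) []
  other-two 1F = 0F , 2F , (λ ()) , (λ ()) , (λ ()) , prep _ (swap _ _ ↭-refl)
  other-two 2F = 0F , 1F , (λ ()) , (λ ()) , (λ ()) , ↭-refl

  -- The two exposed vertices other than the common apex have no neighbours at all.
  isolated-bound : ∀ {es} i → Matching es → All (Triangle i) es →
    3 + 4 * length es ≤ pairSum d (allFin n) + 2 * c
  isolated-bound {es} i M@(vertices , _) all-i with j , k , i≢j , i≢k , j≢k , U↭ ← other-two i = begin
    3 + 4 * length es
      ≡⟨ eq (length es) ⟩
    1 + 2 * ((1 + 2 * length es) * 1)
      ≡⟨ cong (λ s → 1 + 2 * ((1 + s) * 1)) (length-flat es) ⟨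
    1 + 2 * (length X * 1)
      ≤⟨ +-mono-≤ nonadjacent (cross-≥ 1 Z X isolated) ⟩
    pairSum m Z + cross m Z X
      ≤⟨ d-incident W covers Z X allFin↭ ⟩
    pairSum d Z + cross d Z X + 2 * c
      ≤⟨ +-monoˡ-≤ (2 * c) (pairSum-incident W Z X allFin↭) ⟩
    pairSum d (allFin n) + 2 * c ∎
    where
    open ≤-Reasoning
    Z = u j ∷ u k ∷ []
    X = u i ∷ flat es
    eq : ∀ k → 3 + 4 * k ≡ 1 + 2 * ((1 + 2 * k) * 1)
    eq = solve-∀
    allFin↭ : allFin n ↭ Z ++ X ++ []
    allFin↭ = ↭-trans (↭-sym vertices) (↭-trans (++⁺ʳ (flat es) (↭-sym U↭))
      (++⁺ˡ (u j ∷ u k ∷ u i ∷ []) (↭-sym (++-identityʳ (flat es)))))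
    nonadjacent : 1 ≤ pairSum m Z
    nonadjacent rewrite unmatched-nonadjacent M j≢k = ≤-refl
    away : ∀ {j v} → i ≢ j → v ∈ X → 1 ≤ m (u j) v
    away i≢j (here refl) = ≤-reflexive (sym ([not]-false (unmatched-nonadjacent M (i≢j ∘ sym))))
    away i≢j (there v∈) with ∈-flat⁻ es v∈
    ... | e , e∈ , v∈e with All.lookup all-i e∈ | v∈e
    ...   | ((_ , only) , _) | inj₁ refl = ≤-reflexive (sym ([not]-false (only _ i≢j)))
    ...   | (_ , (_ , only)) | inj₂ refl = ≤-reflexive (sym ([not]-false (only _ i≢j)))
    isolated : ∀ z v → z ∈ Z → v ∈ X → 1 ≤ m z v
    isolated z v (here refl) = away i≢j
    isolated z v (there (here refl)) = away i≢k

  -- The pairs meeting `U` give the target only up to a further `c`. All four pairs between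
  -- triangles with different apexes are missing, at least `4 - 2c` of them deleted, which covers
  -- this since `c ≤ 1`.
  two-apexes-bound : ∀ {es e e′ i j rest} → Matching es → 3 + 4 * length es ≤ 3 + ∑ cost es →
    es ↭ e ∷ e′ ∷ rest → i ≢ j → Triangle i e → Triangle j e′ →
    3 + 4 * length es ≤ pairSum d (allFin n) + 2 * c
  two-apexes-bound {es} {e} {e′} {rest = rest} M cost-es es↭ i≢j tri tri′ = +-cancelʳ-≤ 4 _ _ (begin
    3 + 4 * length es + 4
      ≤⟨ +-mono-≤ (≤-trans cost-es (costs-≤ M)) (≤-trans (cross-≥ 1 Z X apart) (m≤n+m _ (pairSum m Z))) ⟩
    S + 3 * c + (pairSum m Z + cross m Z X)
      ≤⟨ +-monoʳ-≤ (S + 3 * c) (d-incident W covers Z X allFin↭) ⟩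
    S + 3 * c + (pairSum d Z + cross d Z X + 2 * c)
      -- The allowance `3 * c` is relaxed to 4, so that it cancels against the four missing pairs.
      ≤⟨ +-mono-≤ (+-monoʳ-≤ S (≤-trans (*-monoʳ-≤ 3 c≤1) (n≤1+n 3)))
           (+-monoˡ-≤ (2 * c) (pairSum-incident W Z X (flat-↭ es↭))) ⟩
    S + 4 + (pairSum d (flat es) + 2 * c)
      ≡⟨ rearrange S (pairSum d (flat es)) (2 * c) ⟩
    S + pairSum d (flat es) + 2 * c + 4
      ≡⟨ cong (λ s → s + 2 * c + 4) (total M) ⟨
    pairSum d (allFin n) + 2 * c + 4 ∎)
    where
    open ≤-Reasoning
    Z = flat (e ∷ [])
    X = flat (e′ ∷ [])
    S = pairSum d U + cross d U (flat es)
    M′ = Matching-resp-↭ es↭ M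
    apart : ∀ v w → v ∈ Z → w ∈ X → 1 ≤ m v w
    apart v w v∈ w∈ = ≤-reflexive (sym ([not]-false (triangles-nonadjacent M′ i≢j tri tri′ v∈ w∈)))
    allFin↭ : allFin n ↭ Z ++ X ++ (flat rest ++ U)
    allFin↭ = ↭-trans (↭-sym (proj₁ M′)) (++-comm U _)
    rearrange : ∀ a b d → a + 4 + (b + d) ≡ a + b + d + 4
    rearrange = solve-∀

  same-apex : ∀ i {ts} → All (λ e → ∃ λ j → Triangle j e) ts →
    All (Triangle i) ts ⊎ ∃ λ e → ∃ λ j → e ∈ ts × i ≢ j × Triangle j e
  same-apex i [] = inj₁ []
  same-apex i ((j , tri) ∷ tris) with i ≟ j
  ... | no i≢j = inj₂ (_ , j , here refl , i≢j , tri)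
  ... | yes refl with same-apex i tris
  ...   | inj₁ same = inj₁ (tri ∷ same)
  ...   | inj₂ (e , j , e∈ , different) = inj₂ (e , j , there e∈ , different)

  triangles-bound : ∀ {ts} → Matching ts → All (λ e → ∃ λ i → Triangle i e) ts → 5 ≤ length ts →
    3 + 4 * length ts ≤ pairSum d (allFin n) + 2 * c
  triangles-bound {e ∷ ts} M tris@((i , tri) ∷ tris′) _ with same-apex i tris′
  ... | inj₁ same = isolated-bound i M (tri ∷ same)
  ... | inj₂ (e′ , j , e′∈ , i≢j , tri′) = two-apexes-bound M (+-monoʳ-≤ 3 costs)
    (prep e (proj₂ (∈⇒↭ e′∈))) i≢j tri tri′
    where
    costs : 4 * length (e ∷ ts) ≤ ∑ cost (e ∷ ts)
    costs = ≤-trans (≤-reflexive (*-comm 4 (length (e ∷ ts))))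
      (∑-≥ 4 (e ∷ ts) λ _ → triangle-cost ∘ proj₂ ∘ All.lookup tris)

  classified-bound : ∀ {ls ts ps} → Matching (ls ++ ts ++ ps) → All Leaf ls →
    All (λ e → ∃ λ i → Triangle i e) ts → All Poor ps → 5 ≤ length (ls ++ ts ++ ps) →
    3 + 4 * length (ls ++ ts ++ ps) ≤ pairSum d (allFin n) + 2 * c
  classified-bound {[]} {ts} {[]} M _ are-t _ many rewrite ++-identityʳ-≡ ts =
    triangles-bound M are-t many
  classified-bound {ls@(_ ∷ _)} {ts} {ps} M are-l are-t are-p many =
    mixed-bound {ls} {ts} {ps} M are-l are-t are-p many (s≤s z≤n)
  classified-bound {[]} {ts} {ps@(_ ∷ _)} M are-l are-t are-p many =
    mixed-bound {[]} {ts} {ps} M are-l are-t are-p many (s≤s z≤n)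

  -- Since `n = 3 + 2k`, the bound `3 + 4k` from the classification is `2 * n - 3`, one more than
  -- the hypothesis `light` below permits.
  missing-bound : (∀ v w → h v w ≡ h w v) → ∀ {es} → Matching es → 5 ≤ length es →
    2 * n ≤ 3 + (pairSum d (allFin n) + 2 * c)
  missing-bound h-sym {es} (vertices , good) many
    with partition h-sym good (All.tabulate λ {e} e∈ → classify _ _ λ i≢j →
           no-augment₁ (Matching-resp-↭ (proj₂ (∈⇒↭ e∈)) (vertices , good)) i≢j)
  ... | classified {ls} {ts} {ps} same good′ are-l are-t are-p = begin
    2 * n                                     ≡⟨ cong (2 *_) n≡ ⟩
    2 * (3 + 2 * length es)                   ≡⟨ eq (length es) ⟩
    3 + (3 + 4 * length es)                   ≤⟨ +-monoʳ-≤ 3 (subst (λ s → 3 + 4 * s ≤ _) count bound) ⟩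
    3 + (pairSum d (allFin n) + 2 * c)        ∎
    where
    open ≤-Reasoning
    n≡ : n ≡ 3 + 2 * length es
    n≡ = trans (sym (trans (↭-length vertices) (length-tabulate _))) (cong (3 +_) (length-flat es))
    eq : ∀ k → 2 * (3 + 2 * k) ≡ 3 + (3 + 4 * k)
    eq = solve-∀
    M : Matching (ls ++ ts ++ ps)
    M = ↭-trans (++⁺ˡ U same) vertices , good′
    count : length (ls ++ ts ++ ps) ≡ length es
    count = *-cancelˡ-≡ _ _ 2
      (trans (sym (length-flat (ls ++ ts ++ ps))) (trans (↭-length same) (length-flat es)))
    bound : 3 + 4 * length (ls ++ ts ++ ps) ≤ pairSum d (allFin n) + 2 * c
    bound = classified-bound {ls} {ts} {ps} M are-l are-t are-p (subst (5 ≤_) (sym count) many)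

-- Existence of almost-perfect matchings

addEdge : (Fin n → Fin n → Bool) → Fin n × Fin n → Fin n → Fin n → Bool
addEdge h e v w = h v w ∨ does (joined? (e ∷ []) v w)

addEdges : (Fin n → Fin n → Bool) → List (Fin n × Fin n) → Fin n → Fin n → Bool
addEdges h [] = h
addEdges h (e ∷ es) = addEdge (addEdges h es) e

addEdge-sym : (h : Fin n → Fin n → Bool) → (∀ v w → h v w ≡ h w v) → ∀ e v w →
  addEdge h e v w ≡ addEdge h e w v
addEdge-sym h h-sym e v w = cong₂ _∨_ (h-sym v w)
  (does-⇔ (mk⇔ Joined-sym Joined-sym) (joined? (e ∷ []) v w) (joined? (e ∷ []) w v))

addEdges-sym : (h : Fin n → Fin n → Bool) → (∀ v w → h v w ≡ h w v) → ∀ es v w →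
  addEdges h es v w ≡ addEdges h es w v
addEdges-sym h h-sym [] = h-sym
addEdges-sym h h-sym (e ∷ es) = addEdge-sym (addEdges h es) (addEdges-sym h h-sym es) e

addEdges-false : (h : Fin n → Fin n → Bool) → ∀ es {v w} → addEdges h es v w ≡ false → h v w ≡ false
addEdges-false h [] ≡false = ≡false
addEdges-false h (e ∷ es) ≡false = addEdges-false h es (Bool.∨-conicalˡ _ _ ≡false)

addEdges-∈ : (h : Fin n → Fin n → Bool) → ∀ {x y es} → (x , y) ∈ es → addEdges h es x y ≡ true
addEdges-∈ h {x} {y} {_ ∷ es} (here refl) =
  trans (cong (addEdges h es x y ∨_) (dec-true (joined? ((x , y) ∷ []) x y) forward)) (Bool.∨-zeroʳ _)
addEdges-∈ h {x} {y} {e ∷ es} (there ∈es) rewrite addEdges-∈ h {x} {y} ∈es = refl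

module _ {n c} (W : Weights n c) (c≤1 : c ≤ 1) (13≤n : 13 ≤ n)
  (light : 4 + (pairSum (Weights.d W) (allFin n) + 2 * c) ≤ 2 * n) where

  open Weights W

  no-exposed-triple : (h : Fin n → Fin n → Bool) → (∀ v w → h v w ≡ h w v) → Covers W h →
    ¬ NearPerfect h → ∀ (u : Fin 3 → Fin n) {es} → (tabulate u ++ flat es) ↭ allFin n →
    ¬ All (λ (x , y) → h x y ≡ true) es
  no-exposed-triple h h-sym covers ¬np u {es} vertices good = <⇒≱ light
    (CountMissing.missing-bound W c≤1 h covers ¬np u h-sym (vertices , good) many)
    where
    n≡ : 3 + 2 * length es ≡ n
    n≡ = trans (cong (3 +_) (sym (length-flat es))) (trans (↭-length vertices) (length-tabulate _))
    many : 5 ≤ length es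
    many = *-cancelˡ-≤ 2 (+-cancelˡ-≤ 3 10 (2 * length es) (subst (13 ≤_) (sym n≡) 13≤n))

  -- An almost-perfect matching of the larger graph either lies in `h`, or contains the added edge;
  -- discarding that edge exposes its two ends besides `w`.
  remove-edge : (h : Fin n → Fin n → Bool) → (∀ v w → h v w ≡ h w v) → Covers W h →
    ¬ NearPerfect h → ∀ e → ¬ NearPerfect (addEdge h e)
  remove-edge h h-sym covers ¬np (a , b) (w , es , vertices , good)
    with All.decide (λ (x , y) → toSum (h x y Bool.≟ true)) es
  ... | inj₁ all-h = ¬np (w , es , vertices , all-h)
  ... | inj₂ some with find some
  ...   | (x , y) , e∈₀ , ¬h with es′ , es↭ ← ∈⇒↭ e∈₀ =
    no-exposed-triple h h-sym covers ¬np u vertices′ (All.tabulate good′)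
    where
    u : Fin 3 → Fin n
    u 0F = w
    u 1F = x
    u 2F = y
    vertices′ : (tabulate u ++ flat es′) ↭ allFin n
    vertices′ = ↭-trans (prep w (↭-sym (flat-↭ es↭))) vertices
    uniq : Unique (x ∷ y ∷ flat es′)
    uniq with _ ∷ uniq ← Unique-resp-↭ (↭-sym vertices′) (allFin⁺ n) = uniq
    joined : ∀ {e} → e ∈ es → ¬ (h (proj₁ e) (proj₂ e) ≡ true) → Joined ((a , b) ∷ []) (proj₁ e) (proj₂ e)
    joined {x , y} e∈ ¬h = does-true⇒ (joined? ((a , b) ∷ []) x y)
      (trans (sym (cong (_∨ does (joined? ((a , b) ∷ []) x y)) (not-≢true ¬h))) (All.lookup good e∈))
    meets : ∀ {x y x′ y′} → Joined ((a , b) ∷ []) x y → Joined ((a , b) ∷ []) x′ y′ →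
      x′ ∈ x ∷ y ∷ []
    meets forward forward = here refl
    meets forward backward = there (here refl)
    meets backward forward = there (here refl)
    meets backward backward = here refl
    -- Any matching edge outside `h` joins the ends of the added edge, and disjointness leaves room
    -- for only one such edge.
    good′ : ∀ {e} → e ∈ es′ → h (proj₁ e) (proj₂ e) ≡ true
    good′ {e} e∈ with h (proj₁ e) (proj₂ e) Bool.≟ true
    ... | yes t = t
    ... | no ¬h′ = contradiction (∈-flat⁺ e∈)
      (Unique-++⇒disjoint (x ∷ y ∷ []) uniq
        (meets (joined {x , y} e∈₀ ¬h) (joined (∈-resp-↭ (↭-sym es↭) (there e∈)) ¬h′)))

  -- The removals are run in reverse: from the assumption that `h` has no near-perfect matching, the
  -- same follows after adding any edges, in particular a whole pairing, which is itself one. Being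
  -- a refutation, this yields only a double negation.
  near-perfect : ∀ k → n ≡ 1 + 2 * k → (h : Fin n → Fin n → Bool) → (∀ v w → h v w ≡ h w v) →
    Covers W h → ¬ ¬ NearPerfect h
  near-perfect k n≡ h h-sym covers ¬np
    with w , es , allFin≡ ← flat-pairing k (allFin n) (trans (length-tabulate _) n≡) =
    without es (w , es , ↭-reflexive (sym allFin≡) , All.tabulate (addEdges-∈ h))
    where
    without : ∀ es → ¬ NearPerfect (addEdges h es)
    without [] = ¬np
    without (e ∷ es) = remove-edge (addEdges h es) (addEdges-sym h h-sym es)
      (λ v w → covers v w ∘ addEdges-false h es) (without es) e

-- Deciding whether a matching exists

module _ (H : Graph n) where

  Saturating : Graph n → Set
  Saturating M = IsPerfectMatching H M ⊎ IsAlmostPerfectMatching H M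

  Saturating? : (M : Graph n) → Dec (Saturating M)
  Saturating? M =
    (M⊆H? ×-dec all? λ v → deg M v ≟ℕ 1) ⊎-dec
    (M⊆H? ×-dec any? λ w → (deg M w ≟ℕ 0) ×-dec all? λ v → ¬? (v ≟ w) →-dec (deg M v ≟ℕ 1))
    where
    M⊆H? : Dec (M ⊆G H)
    M⊆H? = all? λ i → all? λ j → (adj M i j Bool.≟ true) →-dec (adj H i j Bool.≟ true)

  -- Needed because decoding an encoded graph recovers its adjacency only pointwise.
  Saturating-resp : (M N : Graph n) → (∀ i j → adj M i j ≡ adj N i j) → Saturating M → Saturating N
  Saturating-resp M N M≗N = λ
    { (inj₁ (M⊆H , degs)) → inj₁ (N⊆H M⊆H , λ v → trans (sym (deg≡ v)) (degs v))
    ; (inj₂ (M⊆H , w , deg-w , degs)) → inj₂ (N⊆H M⊆H , w , trans (sym (deg≡ w)) deg-w ,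
        λ v v≢w → trans (sym (deg≡ v)) (degs v v≢w)) }
    where
    N⊆H : M ⊆G H → N ⊆G H
    N⊆H M⊆H i j = M⊆H i j ∘ trans (M≗N i j)
    deg≡ : ∀ v → deg M v ≡ deg N v
    deg≡ v = ∑-cong (λ w → cong [_] (M≗N v w)) (allFin n)

  -- A graph on n vertices is encoded by its adjacency matrix, a subset of Fin (n * n).
  decode : Subset (n * n) → Fin n → Fin n → Bool
  decode s i j = Vec.lookup s (combine i j)

  encode : Graph n → Subset (n * n)
  encode M = Vec.tabulate (uncurry (adj M) ∘ remQuot n)

  decode-encode : ∀ M i j → decode (encode M) i j ≡ adj M i j
  decode-encode M i j = trans (lookup∘tabulate _ (combine i j))
    (cong (uncurry (adj M)) (remQuot-combine i j))

  decoded : (s : Subset (n * n)) → (∀ i j → decode s i j ≡ decode s j i) →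
    (∀ i → decode s i i ≡ false) → Graph n
  decoded s symm irr = record { adj = decode s ; sym = symm ; irrefl = irr }

  SaturatingCode : Subset (n * n) → Set
  SaturatingCode s = Σ (∀ i j → decode s i j ≡ decode s j i) λ symm →
    Σ (∀ i → decode s i i ≡ false) λ irr →
    Saturating (decoded s symm irr)

  SaturatingCode? : ∀ s → Dec (SaturatingCode s)
  SaturatingCode? s
    with all? (λ i → all? λ j → decode s i j Bool.≟ decode s j i)
       | all? (λ i → decode s i i Bool.≟ false)
  ... | no ¬symm | _ = no (¬symm ∘ proj₁)
  ... | yes _ | no ¬irr = no (¬irr ∘ proj₁ ∘ proj₂)
  -- `Saturating` looks only at adjacency, so a witness built with other proofs of symmetry and
  -- irreflexivity has the same type.
  ... | yes symm | yes irr = map′ (λ sat → symm , irr , sat) (proj₂ ∘ proj₂)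
    (Saturating? (decoded s symm irr))

  -- Exhaustive search over adjacency matrices; its purpose is to discharge the double negation left
  -- by `near-perfect`.
  HasPMorAPM? : Dec (HasPMorAPM H)
  HasPMorAPM? = map′ (λ (s , symm , irr , sat) → decoded s symm irr , sat) encoded
    (anySubset? SaturatingCode?)
    where
    encoded : HasPMorAPM H → ∃ SaturatingCode
    encoded (M , sat) = encode M , symm , irr ,
      Saturating-resp M (decoded (encode M) symm irr) (λ i j → sym (decode-encode M i j)) sat
      where
      symm : ∀ i j → decode (encode M) i j ≡ decode (encode M) j i
      symm i j = trans (decode-encode M i j) (trans (adj-sym M i j) (sym (decode-encode M j i)))
      irr : ∀ i → decode (encode M) i i ≡ false
      irr i = trans (decode-encode M i i) (irrefl M i)

-- Degrees, edge counts, and isolating two vertices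

-- The vertex v is counted among its own non-neighbours.
codeg : Graph n → Fin n → ℕ
codeg {n} G v = ∑ (λ w → [ not (adj G v w) ]) (allFin n)

nonEdges : Graph n → ℕ
nonEdges {n} G = pairSum (λ v w → [ not (adj G v w) ]) (allFin n)

deletedEdges : Graph n → Graph n → ℕ
deletedEdges {n} G H = pairSum (λ v w → [ adj G v w ∧ not (adj H v w) ]) (allFin n)

∑-allFin-1 : ∀ n → ∑ (λ _ → 1) (allFin n) ≡ n
∑-allFin-1 n = trans (∑-const 1 (allFin n)) (trans (*-identityʳ _) (length-tabulate {n = n} (λ i → i)))

deg+codeg : (G : Graph n) (v : Fin n) → deg G v + codeg G v ≡ n
deg+codeg {n} G v = trans (sym (∑-distrib-+ _ _ (allFin n)))
  (trans (∑-cong (λ w → [b]+[not-b] (adj G v w)) (allFin n)) (∑-allFin-1 n))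
  where
  [b]+[not-b] : ∀ b → [ b ] + [ not b ] ≡ 1
  [b]+[not-b] true = refl
  [b]+[not-b] false = refl

<ᵇ-true : ∀ {a b} → a < b → (a <ᵇ b) ≡ true
<ᵇ-true a<b = Equivalence.to Bool.T-≡ (<⇒<ᵇ a<b)

<ᵇ-false : ∀ {a b} → ¬ a < b → (a <ᵇ b) ≡ false
<ᵇ-false ¬a<b = not-≢true λ t → ¬a<b (<ᵇ⇒< _ _ (Equivalence.from Bool.T-≡ t))

-- Adding the ordered count to its transpose removes the condition on the order of the ends; both
-- sides become half of the symmetric double sum with zero diagonal.
edgeCount≡pairSum : (G : Graph n) → edgeCount G ≡ pairSum (λ v w → [ adj G v w ]) (allFin n)
edgeCount≡pairSum {n} G = *-cancelˡ-≡ _ _ 2 (begin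
  2 * cross ordered V V
    ≡⟨ cong (cross ordered V V +_) (+-identityʳ _) ⟩
  cross ordered V V + cross ordered V V
    ≡⟨ cong (cross ordered V V +_) (∑-swap ordered V V) ⟩
  cross ordered V V + cross (λ v w → ordered w v) V V
    ≡⟨ cross-distrib-+ ordered (λ v w → ordered w v) V V ⟨
  cross (λ v w → ordered v w + ordered w v) V V
    ≡⟨ ∑-cong (λ v → ∑-cong (both v) V) V ⟩
  cross edge V V
    ≡⟨ cross-diagonal edge (λ v w → cong [_] (adj-sym G v w)) V ⟩
  2 * pairSum edge V + ∑ (λ v → edge v v) V
    ≡⟨ cong (2 * pairSum edge V +_) (trans (∑-cong (λ v → []-false (irrefl G v)) V)
         (trans (∑-const 0 V) (*-zeroʳ (length V)))) ⟩
  2 * pairSum edge V + 0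
    ≡⟨ +-identityʳ _ ⟩
  2 * pairSum edge V ∎)
  where
  open ≡-Reasoning
  V = allFin n
  edge : Fin n → Fin n → ℕ
  edge v w = [ adj G v w ]
  ordered : Fin n → Fin n → ℕ
  ordered v w = [ adj G v w ∧ (toℕ v <ᵇ toℕ w) ]
  both : ∀ v w → ordered v w + ordered w v ≡ edge v w
  both v w rewrite adj-sym G w v with adj G v w in v~w
  ... | false = refl
  ... | true with <-cmp (toℕ v) (toℕ w)
  ...   | tri< v<w _ w≮v rewrite <ᵇ-true v<w | <ᵇ-false w≮v = refl
  ...   | tri> v≮w _ w<v rewrite <ᵇ-true w<v | <ᵇ-false v≮w = refl
  ...   | tri≈ _ v≡w _ with refl ← toℕ-injective v≡w = contradiction (trans (sym v~w) (irrefl G v)) λ ()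

edgeCount-∸ : (G H : Graph n) → H ⊆G G → edgeCount G ∸ edgeCount H ≡ deletedEdges G H
edgeCount-∸ {n} G H H⊆G = begin
  edgeCount G ∸ edgeCount H
    ≡⟨ cong₂ _∸_ (edgeCount≡pairSum G) (edgeCount≡pairSum H) ⟩
  pairSum (λ v w → [ adj G v w ]) V ∸ P
    ≡⟨ cong (_∸ P) (trans (pairSum-cong split V) (pairSum-distrib-+ _ _ V)) ⟩
  P + deletedEdges G H ∸ P
    ≡⟨ m+n∸m≡n P _ ⟩
  deletedEdges G H ∎
  where
  open ≡-Reasoning
  V = allFin n
  P = pairSum (λ v w → [ adj H v w ]) V
  split : ∀ v w → [ adj G v w ] ≡ [ adj H v w ] + [ adj G v w ∧ not (adj H v w) ]
  split v w with adj H v w in v~w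
  ... | false = cong [_] (sym (Bool.∧-identityʳ (adj G v w)))
  ... | true rewrite H⊆G v w v~w = refl

nonEdges-≤ : (G H : Graph n) → nonEdges H ≤ deletedEdges G H + nonEdges G
nonEdges-≤ {n} G H = ≤-trans (pairSum-mono pointwise (allFin n))
  (≤-reflexive (pairSum-distrib-+ _ _ (allFin n)))
  where
  pointwise : ∀ v w → [ not (adj H v w) ] ≤ [ adj G v w ∧ not (adj H v w) ] + [ not (adj G v w) ]
  pointwise v w with adj G v w | adj H v w
  ... | true | true = z≤n
  ... | true | false = ≤-refl
  ... | false | true = z≤n
  ... | false | false = ≤-refl

∑-*ˡ : (a : ℕ) (f : A → ℕ) (xs : List A) → ∑ (λ x → a * f x) xs ≡ a * ∑ f xs
∑-*ˡ a f [] = sym (*-zeroʳ a)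
∑-*ˡ a f (x ∷ xs) = trans (cong (a * f x +_) (∑-*ˡ a f xs)) (sym (*-distribˡ-+ a (f x) (∑ f xs)))

-- In the full double sum each vertex contributes its diagonal entry and each listed pair
-- contributes two indicators, one per orientation; the list may repeat pairs.
nonEdges-≤-length : (G : Graph n) (ps : List (Fin n × Fin n)) →
  (∀ v w → v ≢ w → adj G v w ≡ false → Joined ps v w) → nonEdges G ≤ length ps
nonEdges-≤-length {n} G ps listed = *-cancelˡ-≤ 2 (+-cancelʳ-≤ n _ _ (begin
  2 * nonEdges G + n
    ≡⟨ cong (2 * nonEdges G +_) (trans (sym (∑-allFin-1 n))
         (∑-cong (λ v → sym ([not]-false (irrefl G v))) V)) ⟩
  2 * nonEdges G + ∑ (λ v → m v v) V
    ≡⟨ cross-diagonal m (λ v w → cong ([_] ∘ not) (adj-sym G v w)) V ⟨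
  cross m V V
    ≤⟨ cross-mono pointwise V V ⟩
  cross (λ v w → point v w + ∑ (λ p → edge p v w) ps) V V
    ≡⟨ cross-distrib-+ point (λ v w → ∑ (λ p → edge p v w) ps) V V ⟩
  cross point V V + cross (λ v w → ∑ (λ p → edge p v w) ps) V V
    ≡⟨ cong₂ _+_ (trans (∑-cong count-point V) (∑-allFin-1 n)) (edges ps) ⟩
  n + 2 * length ps
    ≡⟨ +-comm n _ ⟩
  2 * length ps + n ∎))
  where
  open ≤-Reasoning
  V = allFin n
  m : Fin n → Fin n → ℕ
  m v w = [ not (adj G v w) ]
  point : Fin n → Fin n → ℕ
  point v w = [ does (v ≟ w) ]
  edge : Fin n × Fin n → Fin n → Fin n → ℕ
  edge (a , b) v w = point a v * point b w + point b v * point a w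
  one-way : ∀ a b → cross (λ v w → point a v * point b w) V V ≡ 1
  one-way a b = trans (∑-cong (λ v → trans (∑-*ˡ (point a v) (point b) V)
    (trans (cong (point a v *_) (count-point b)) (*-identityʳ _))) V) (count-point a)
  edges : ∀ ps → cross (λ v w → ∑ (λ p → edge p v w) ps) V V ≡ 2 * length ps
  edges [] = trans (∑-cong (λ _ → trans (∑-const 0 V) (*-zeroʳ (length V))) V)
    (trans (∑-const 0 V) (*-zeroʳ (length V)))
  edges (p@(a , b) ∷ ps) =
    trans (cross-distrib-+ (edge p) (λ v w → ∑ (λ q → edge q v w) ps) V V)
    (trans (cong₂ _+_ (trans (cross-distrib-+ _ (λ v w → point b v * point a w) V V)
      (cong₂ _+_ (one-way a b) (one-way b a))) (edges ps)) (sym (*-suc 2 (length ps))))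
  point-refl : ∀ v → point v v ≡ 1
  point-refl v = []-true (dec-true (v ≟ v) refl)
  joined-edge : ∀ {ps v w} → Joined ps v w → 1 ≤ ∑ (λ p → edge p v w) ps
  joined-edge {(x , y) ∷ _} forward rewrite point-refl x | point-refl y = s≤s z≤n
  joined-edge {(x , y) ∷ _} backward rewrite point-refl x | point-refl y =
    ≤-trans (m≤n+m 1 (point x y * point y x)) (m≤m+n _ _)
  joined-edge (later j) = ≤-trans (joined-edge j) (m≤n+m _ _)
  pointwise : ∀ v w → m v w ≤ point v w + ∑ (λ p → edge p v w) ps
  pointwise v w with adj G v w in v~w | v ≟ w
  ... | true | _ = z≤n
  ... | false | yes _ = s≤s z≤n
  ... | false | no v≢w = joined-edge (listed v w v≢w v~w)

-- Finding and counting non-neighbours; the minimum degree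

_∈?_ : (v : Fin n) (xs : List (Fin n)) → Dec (v ∈ xs)
_∈?_ = DecMembership._∈?_ _≟_

count-find : (f : Fin n → Bool) {xs : List (Fin n)} → Unique xs →
  length xs < ∑ ([_] ∘ f) (allFin n) → ∃ λ v → v ∉ xs × f v ≡ true
count-find f {xs} uniq few with any? (λ v → ¬? (v ∈? xs) ×-dec (f v Bool.≟ true))
... | yes found = found
... | no none = contradiction (count-≤ f uniq λ v fv →
  decidable-stable (v ∈? xs) λ v∉ → none (v , v∉ , fv)) (<⇒≱ few)

find-nonneighbour : (G : Graph n) {v : Fin n} {xs : List (Fin n)} → Unique xs →
  length xs < codeg G v → ∃ λ w → w ∉ xs × adj G v w ≡ false
find-nonneighbour G {v} uniq few with w , w∉ , ≁ ← count-find (not ∘ adj G v) uniq few =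
  w , w∉ , Bool.not-injective ≁

codeg-≥ : (G : Graph n) {v : Fin n} {xs : List (Fin n)} → Unique xs →
  (∀ w → w ∈ xs → adj G v w ≡ false) → length xs ≤ codeg G v
codeg-≥ G {v} uniq ≁ = count-≥ (not ∘ adj G v) uniq λ w w∈ → cong not (≁ w w∈)

codeg-≤ : (G : Graph n) {v : Fin n} {xs : List (Fin n)} → Unique xs →
  (∀ w → adj G v w ≡ false → w ∈ xs) → codeg G v ≤ length xs
codeg-≤ G {v} uniq only = count-≤ (not ∘ adj G v) uniq λ w ≁ → only w (Bool.not-injective ≁)

δ≤deg : (G : Graph n) (v : Fin n) → δ G ≤ deg G v
δ≤deg {n} G v = below (allFin n) (∈-allFin v)
  where
  below : ∀ vs → v ∈ vs → foldr (λ w m → deg G w ⊓ m) n vs ≤ deg G v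
  below (w ∷ vs) (here refl) = m⊓n≤m _ _
  below (w ∷ vs) (there v∈) = ≤-trans (m⊓n≤n _ _) (below vs v∈)

δ-glb : (G : Graph n) {m : ℕ} → m ≤ n → (∀ v → m ≤ deg G v) → m ≤ δ G
δ-glb {n} G {m} m≤n m≤deg = above (allFin n)
  where
  above : ∀ vs → m ≤ foldr (λ w k → deg G w ⊓ k) n vs
  above [] = m≤n
  above (w ∷ vs) = ⊓-glb (m≤deg w) (above vs)

pairSum-zero : (f : A → A → ℕ) (xs : List A) →
  (∀ x y → x ∈ xs → y ∈ xs → f x y ≡ 0) → pairSum f xs ≡ 0
pairSum-zero f [] _ = refl
pairSum-zero f (x ∷ xs) f≡0 = cong₂ _+_
  (n≤0⇒n≡0 (≤-trans (∑-≤ 0 xs λ y y∈ → ≤-reflexive (f≡0 x y (here refl) (there y∈)))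
    (≤-reflexive (*-zeroʳ (length xs)))))
  (pairSum-zero f xs λ y z y∈ z∈ → f≡0 y z (there y∈) (there z∈))

-- Deleting all edges at two vertices

module _ (G : Graph n) {a b : Fin n} (a≢b : a ≢ b) where

  private
    inner : Fin n → Bool
    inner v = not (does (v ≟ a)) ∧ not (does (v ≟ b))

    inner-a : inner a ≡ false
    inner-a rewrite dec-true (a ≟ a) refl = refl

    inner-b : inner b ≡ false
    inner-b rewrite dec-true (b ≟ b) refl = Bool.∧-zeroʳ _

    inner-other : ∀ {v} → v ∉ a ∷ b ∷ [] → inner v ≡ true
    inner-other {v} v∉ rewrite dec-false (v ≟ a) (v∉ ∘ here) | dec-false (v ≟ b) (v∉ ∘ there ∘ here) = refl

  isolate : Graph n
  isolate = record
    { adj = λ v w → adj G v w ∧ (inner v ∧ inner w)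
    ; sym = λ v w → cong₂ _∧_ (adj-sym G v w) (Bool.∧-comm (inner v) (inner w))
    ; irrefl = λ v → cong (_∧ (inner v ∧ inner v)) (irrefl G v)
    }

  isolate-⊆ : isolate ⊆G G
  isolate-⊆ v w ~ with true ← adj G v w = refl

  isolate-¬HasPMorAPM : ¬ HasPMorAPM isolate
  isolate-¬HasPMorAPM (M , matched) = impossible matched
    where
    isolated : ∀ v → inner v ≡ false → M ⊆G isolate → deg M v ≡ 0
    isolated v outer M⊆ = n≤0⇒n≡0 (count-≤ (adj M v) [] λ w m →
      contradiction (trans (sym (M⊆ v w m))
        (trans (cong (λ o → adj G v w ∧ (o ∧ inner w)) outer) (Bool.∧-zeroʳ _))) λ ())
    impossible : ¬ (IsPerfectMatching isolate M ⊎ IsAlmostPerfectMatching isolate M)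
    impossible (inj₁ (M⊆ , degs)) = 1+n≢0 (trans (sym (degs a)) (isolated a inner-a M⊆))
    impossible (inj₂ (M⊆ , w , _ , degs)) with a ≟ w
    ... | no a≢w = 1+n≢0 (trans (sym (degs a a≢w)) (isolated a inner-a M⊆))
    ... | yes refl = 1+n≢0 (trans (sym (degs b (a≢b ∘ sym))) (isolated b inner-b M⊆))

  -- The two degrees count the edge between `a` and `b`, if present, twice. Adding the
  -- non-neighbours instead of subtracting keeps the identity free of truncated subtraction.
  deletedEdges-isolate : deletedEdges G isolate + (codeg G a + codeg G b + [ adj G a b ]) ≡ 2 * n
  deletedEdges-isolate with ys , allFin↭ , disjoint ← complement {xs = a ∷ b ∷ []} ((a≢b ∷ []) ∷ [] ∷ []) =
    begin
    pairSum d V + (codeg G a + codeg G b + g a b)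
      ≡⟨ cong (_+ (codeg G a + codeg G b + g a b)) (trans (pairSum-↭ d d-sym allFin↭) rows) ⟩
    (g a b + ∑ (g a) ys) + ∑ (g b) ys + (codeg G a + codeg G b + g a b)
      ≡⟨ rearrange (g a b) (∑ (g a) ys) (∑ (g b) ys) (codeg G a) (codeg G b) ⟩
    (g a b + ∑ (g a) ys + codeg G a) + (g a b + ∑ (g b) ys + codeg G b)
      ≡⟨ cong₂ (λ s t → (s + codeg G a) + (t + codeg G b)) deg-a deg-b ⟨
    (deg G a + codeg G a) + (deg G b + codeg G b)
      ≡⟨ cong₂ _+_ (deg+codeg G a) (trans (deg+codeg G b) (sym (+-identityʳ n))) ⟩
    2 * n ∎
    where
    open ≡-Reasoning
    V = allFin n
    g d : Fin n → Fin n → ℕ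
    g v w = [ adj G v w ]
    d v w = [ adj G v w ∧ not (adj isolate v w) ]
    d-sym : ∀ v w → d v w ≡ d w v
    d-sym v w = cong₂ (λ x y → [ x ∧ not y ]) (adj-sym G v w) (adj-sym isolate v w)
    outer-row : ∀ v → inner v ≡ false → ∀ w → d v w ≡ g v w
    outer-row v outer w rewrite outer | Bool.∧-zeroʳ (adj G v w) = cong [_] (Bool.∧-identityʳ _)
    inner-pair : ∀ v w → v ∈ ys → w ∈ ys → d v w ≡ 0
    inner-pair v w v∈ w∈
      rewrite inner-other {v} (λ v∈ab → disjoint v∈ab v∈) | inner-other {w} (λ w∈ab → disjoint w∈ab w∈)
            | Bool.∧-identityʳ (adj G v w) = cong [_] (Bool.∧-inverseʳ (adj G v w))
    rows : pairSum d (a ∷ b ∷ ys) ≡ (g a b + ∑ (g a) ys) + ∑ (g b) ys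
    rows = cong₂ _+_ (cong₂ _+_ (outer-row a inner-a b) (∑-cong (outer-row a inner-a) ys))
      (trans (cong₂ _+_ (∑-cong (outer-row b inner-b) ys) (pairSum-zero d ys inner-pair)) (+-identityʳ _))
    deg-a : deg G a ≡ g a b + ∑ (g a) ys
    deg-a = trans (∑-↭ (g a) allFin↭) (cong (_+ (g a b + ∑ (g a) ys)) ([]-false (irrefl G a)))
    deg-b : deg G b ≡ g a b + ∑ (g b) ys
    deg-b = trans (∑-↭ (g b) allFin↭)
      (cong₂ _+_ (cong [_] (adj-sym G b a)) (cong (_+ ∑ (g b) ys) ([]-false (irrefl G b))))
    rearrange : ∀ e s t p q → (e + s) + t + (p + q + e) ≡ (e + s + p) + (e + t + q)
    rearrange = solve-∀

-- The characterisation

module _ (n-odd : n % 2 ≡ 1) (13≤n : 13 ≤ n) where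

  2n∸5+5 : 2 * n ∸ 5 + 5 ≡ 2 * n
  2n∸5+5 = m∸n+n≡m (≤-trans (m≤m+n 5 8) (≤-trans 13≤n (m≤m+n n _)))

  n∸2+2 : n ∸ 2 + 2 ≡ n
  n∸2+2 = m∸n+n≡m (≤-trans (m≤m+n 2 11) 13≤n)

  n≡1+2k : n ≡ 1 + 2 * (n / 2)
  n≡1+2k = trans (m≡m%n+[m/n]*n n 2) (cong₂ _+_ n-odd (*-comm (n / 2) 2))

  light⇒HasPMorAPM : ∀ {c} (W : Weights n c) (H : Graph n) → c ≤ 1 → Covers W (adj H) →
    4 + (pairSum (Weights.d W) (allFin n) + 2 * c) ≤ 2 * n → HasPMorAPM H
  light⇒HasPMorAPM W H c≤1 covers light = decidable-stable (HasPMorAPM? H) λ ¬has →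
    near-perfect W c≤1 13≤n light (n / 2) n≡1+2k (adj H) (adj-sym H) covers
      (¬has ∘ NearPerfect⇒HasPMorAPM H)

  -- The case `c = 0`: all missing edges are charged to `d`, and `ν` is only the diagonal.
  few-nonEdges⇒HasPMorAPM : (H : Graph n) → 4 + nonEdges H ≤ 2 * n → HasPMorAPM H
  few-nonEdges⇒HasPMorAPM H few = light⇒HasPMorAPM W H z≤n covers
    (≤-trans (≤-reflexive (cong (4 +_) (+-identityʳ _))) few)
    where
    W : Weights n 0
    W = record
      { d = λ v w → [ not (adj H v w) ]
      ; ν = λ v w → [ does (v ≟ w) ]
      ; d-sym = λ v w → cong ([_] ∘ not) (adj-sym H v w)
      ; ν-sym = λ v w → cong [_] (does-⇔ (mk⇔ sym sym) (v ≟ w) (w ≟ v))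
      ; ν-diagonal = λ v → ≤-reflexive (sym ([]-true (dec-true (v ≟ v) refl)))
      ; ν-row = λ v → ≤-reflexive (count-point v)
      }
    covers : Covers W (adj H)
    covers v w ≁ = ≤-trans (≤-reflexive (sym ([not]-false ≁))) (m≤m+n _ _)

  -- The case `c = 1`: non-edges of `G` go to `ν`, so their total number does not matter. `codeg`
  -- includes the vertex itself, hence the row bound 2.
  codeg≤2⇒HasPMorAPM : (G H : Graph n) → (∀ v → codeg G v ≤ 2) →
    deletedEdges G H < 2 * n ∸ 5 → HasPMorAPM H
  codeg≤2⇒HasPMorAPM G H codeg≤2 few = light⇒HasPMorAPM W H ≤-refl covers (begin
    4 + (deletedEdges G H + 2)  ≡⟨ eq (deletedEdges G H) ⟩
    suc (deletedEdges G H) + 5  ≤⟨ +-monoˡ-≤ 5 few ⟩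
    2 * n ∸ 5 + 5               ≡⟨ 2n∸5+5 ⟩
    2 * n                       ∎)
    where
    open ≤-Reasoning
    eq : ∀ D → 4 + (D + 2) ≡ suc D + 5
    eq = solve-∀
    W : Weights n 1
    W = record
      { d = λ v w → [ adj G v w ∧ not (adj H v w) ]
      ; ν = λ v w → [ not (adj G v w) ]
      ; d-sym = λ v w → cong₂ (λ x y → [ x ∧ not y ]) (adj-sym G v w) (adj-sym H v w)
      ; ν-sym = λ v w → cong ([_] ∘ not) (adj-sym G v w)
      ; ν-diagonal = λ v → ≤-reflexive (sym ([not]-false (irrefl G v)))
      ; ν-row = codeg≤2
      }
    covers : Covers W (adj H)
    covers v w ≁ rewrite ≁ with adj G v w
    ... | true = s≤s z≤n
    ... | false = s≤s z≤n

  module _ (G : Graph n) where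

    private
      mp : Set
      mp = MatchingPreclusionNumber G (2 * n ∸ 5)

      P₃-complement : Set
      P₃-complement = Σ (Fin n) λ a → Σ (Fin n) λ b → Σ (Fin n) λ c → IsKnMinusP3 G a b c

      G≁ : ∀ {v w} → adj G v w ≡ false → adj G w v ≡ false
      G≁ {v} {w} = trans (adj-sym G w v)

    -- Sufficiency of the two conditions

    cheap-isolation⇒mp : ∀ {a b} → a ≢ b → codeg G a + codeg G b + [ adj G a b ] ≡ 5 →
      (∀ H → deletedEdges G H < 2 * n ∸ 5 → HasPMorAPM H) → mp
    cheap-isolation⇒mp {a} {b} a≢b sum≡5 robust =
      (isolate G a≢b , isolate-⊆ G a≢b ,
        trans (edgeCount-∸ G (isolate G a≢b) (isolate-⊆ G a≢b)) deleted ,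
        isolate-¬HasPMorAPM G a≢b) ,
      λ H H⊆G few → robust H (subst (_< 2 * n ∸ 5) (edgeCount-∸ G H H⊆G) few)
      where
      deleted : deletedEdges G (isolate G a≢b) ≡ 2 * n ∸ 5
      deleted = +-cancelʳ-≡ 5 _ _ (trans
        (trans (cong (deletedEdges G (isolate G a≢b) +_) (sym sum≡5)) (deletedEdges-isolate G a≢b))
        (sym 2n∸5+5))

    -- Two ends of the same non-edge give only 2 + 2 + 0. Since `G` is not K_n minus an edge there
    -- is a second non-edge, and ends of different non-edges are adjacent, giving 2 + 2 + 1.
    matching-complement⇒mp : δ G ≡ n ∸ 2 → (∀ a b → ¬ IsKnMinusEdge G a b) → mp
    matching-complement⇒mp δ≡ ¬minusEdge
      with any? (λ a → 2 ≤? codeg G a)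
    ... | no all-full = contradiction n∸1≤n∸2 1+n≰n
      where
      n∸1≤n∸2 : suc (n ∸ 2) ≤ n ∸ 2
      n∸1≤n∸2 = subst (suc (n ∸ 2) ≤_) δ≡ (δ-glb G
        (≤-trans (n≤1+n _) (≤-reflexive (trans (+-comm 2 _) n∸2+2)))
        λ v → +-cancelʳ-≤ 1 _ _ (begin
          suc (n ∸ 2) + 1        ≡⟨ +-suc (n ∸ 2) 1 ⟨
          n ∸ 2 + 2              ≡⟨ n∸2+2 ⟩
          n                      ≡⟨ deg+codeg G v ⟨
          deg G v + codeg G v    ≤⟨ +-monoʳ-≤ (deg G v) (s≤s⁻¹ (≰⇒> λ full → all-full (v , full))) ⟩
          deg G v + 1            ∎))
        where open ≤-Reasoning
    ... | yes (a , 2≤a) with b , b∉a , a≁b ← find-nonneighbour G {a} ([] ∷ []) 2≤a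
      with any? (λ i → any? λ j →
        ¬? (i ≟ j) ×-dec (adj G i j Bool.≟ false) ×-dec ¬? (joined? ((a , b) ∷ []) i j))
    ...   | no single = contradiction
      (b∉a ∘ here ∘ sym , λ i j i≢j → only i j i≢j , nonEdge i j) (¬minusEdge a b)
      where
      only : ∀ i j → i ≢ j → adj G i j ≡ false → SameEdge i j a b
      only i j i≢j ≁ with decidable-stable (joined? ((a , b) ∷ []) i j)
        (λ ¬joined → single (i , j , i≢j , ≁ , ¬joined))
      ... | forward = inj₁ (refl , refl)
      ... | backward = inj₂ (refl , refl)
      nonEdge : ∀ i j → SameEdge i j a b → adj G i j ≡ false
      nonEdge i j (inj₁ (refl , refl)) = a≁b
      nonEdge i j (inj₂ (refl , refl)) = G≁ a≁b
    ...   | yes (i , j , i≢j , i≁j , ¬joined) = cheap-isolation⇒mp a≢i sum≡5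
      λ H → codeg≤2⇒HasPMorAPM G H codeg≤2
      where
      a≢b : a ≢ b
      a≢b = b∉a ∘ here ∘ sym
      codeg≤2 : ∀ v → codeg G v ≤ 2
      codeg≤2 v = +-cancelˡ-≤ (n ∸ 2) _ _ (begin
        n ∸ 2 + codeg G v    ≡⟨ cong (_+ codeg G v) δ≡ ⟨
        δ G + codeg G v      ≤⟨ +-monoˡ-≤ (codeg G v) (δ≤deg G v) ⟩
        deg G v + codeg G v  ≡⟨ trans (deg+codeg G v) (sym n∸2+2) ⟩
        n ∸ 2 + 2            ∎)
        where open ≤-Reasoning
      unique-nonneighbour : ∀ {v x y} → v ≢ x → adj G v x ≡ false → adj G v y ≡ false → v ≢ y → x ≡ y
      unique-nonneighbour {v} {x} {y} v≢x v≁x v≁y v≢y with x ≟ y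
      ... | yes x≡y = x≡y
      ... | no x≢y = contradiction (codeg≤2 v) (<⇒≱ (codeg-≥ G ((v≢x ∷ v≢y ∷ []) ∷ (x≢y ∷ []) ∷ [] ∷ []) ≁))
        where
        ≁ : ∀ w → w ∈ v ∷ x ∷ y ∷ [] → adj G v w ≡ false
        ≁ w (here refl) = irrefl G v
        ≁ w (there (here refl)) = v≁x
        ≁ w (there (there (here refl))) = v≁y
      a≢i : a ≢ i
      a≢i refl with refl ← unique-nonneighbour a≢b a≁b i≁j i≢j = ¬joined forward
      b≢i : b ≢ i
      b≢i refl with refl ← unique-nonneighbour (a≢b ∘ sym) (G≁ a≁b) i≁j i≢j = ¬joined backward
      a~i : adj G a i ≡ true
      a~i = Bool.¬-not λ a≁i → b≢i (unique-nonneighbour a≢b a≁b a≁i a≢i)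
      2≤i : 2 ≤ codeg G i
      2≤i = codeg-≥ G ((i≢j ∷ []) ∷ [] ∷ []) λ where
        w (here refl) → irrefl G i
        w (there (here refl)) → i≁j
      sum≡5 : codeg G a + codeg G i + [ adj G a i ] ≡ 5
      sum≡5 = cong₂ _+_ (cong₂ _+_ (≤-antisym (codeg≤2 a) 2≤a) (≤-antisym (codeg≤2 i) 2≤i)) ([]-true a~i)

    -- The centre has `codeg` 3, so the matching-complement route is closed; but counting both
    -- absent edges as deleted still leaves at most `2 * n - 4` missing. An end and the centre
    -- attain 2 + 3 + 0.
    P₃-complement⇒mp : P₃-complement → mp
    P₃-complement⇒mp (a , b , c , a≢b , b≢c , a≢c , nonEdge) =
      cheap-isolation⇒mp a≢b sum≡5 λ H few → few-nonEdges⇒HasPMorAPM H (begin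
        4 + nonEdges H
          ≤⟨ +-monoʳ-≤ 4 (≤-trans (nonEdges-≤ G H) (+-monoʳ-≤ (deletedEdges G H)
               (nonEdges-≤-length G ((a , b) ∷ (b , c) ∷ []) listed))) ⟩
        4 + (deletedEdges G H + 2)   ≡⟨ eq (deletedEdges G H) ⟩
        suc (deletedEdges G H) + 5   ≤⟨ +-monoˡ-≤ 5 few ⟩
        2 * n ∸ 5 + 5                ≡⟨ 2n∸5+5 ⟩
        2 * n                        ∎)
      where
      open ≤-Reasoning
      eq : ∀ D → 4 + (D + 2) ≡ suc D + 5
      eq = solve-∀
      listed : ∀ v w → v ≢ w → adj G v w ≡ false → Joined ((a , b) ∷ (b , c) ∷ []) v w
      listed v w v≢w ≁ with proj₁ (nonEdge v w v≢w) ≁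
      ... | inj₁ (inj₁ (refl , refl)) = forward
      ... | inj₁ (inj₂ (refl , refl)) = backward
      ... | inj₂ (inj₁ (refl , refl)) = later forward
      ... | inj₂ (inj₂ (refl , refl)) = later backward
      a≁b : adj G a b ≡ false
      a≁b = proj₂ (nonEdge a b a≢b) (inj₁ (inj₁ (refl , refl)))
      b≁c : adj G b c ≡ false
      b≁c = proj₂ (nonEdge b c b≢c) (inj₂ (inj₁ (refl , refl)))
      codeg-a : codeg G a ≡ 2
      codeg-a = ≤-antisym (codeg-≤ G uniq only) (codeg-≥ G uniq ≁)
        where
        uniq : Unique (a ∷ b ∷ [])
        uniq = (a≢b ∷ []) ∷ [] ∷ []
        ≁ : ∀ w → w ∈ a ∷ b ∷ [] → adj G a w ≡ false
        ≁ w (here refl) = irrefl G a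
        ≁ w (there (here refl)) = a≁b
        only : ∀ w → adj G a w ≡ false → w ∈ a ∷ b ∷ []
        only w a≁w with a ≟ w
        ... | yes refl = here refl
        ... | no a≢w with listed a w a≢w a≁w
        ...   | forward = there (here refl)
        ...   | backward = here refl
        ...   | later forward = contradiction refl a≢b
        ...   | later backward = there (here refl)
      codeg-b : codeg G b ≡ 3
      codeg-b = ≤-antisym (codeg-≤ G uniq only) (codeg-≥ G uniq ≁)
        where
        uniq : Unique (b ∷ a ∷ c ∷ [])
        uniq = ((a≢b ∘ sym) ∷ b≢c ∷ []) ∷ (a≢c ∷ []) ∷ [] ∷ []
        ≁ : ∀ w → w ∈ b ∷ a ∷ c ∷ [] → adj G b w ≡ false
        ≁ w (here refl) = irrefl G b
        ≁ w (there (here refl)) = G≁ a≁b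
        ≁ w (there (there (here refl))) = b≁c
        only : ∀ w → adj G b w ≡ false → w ∈ b ∷ a ∷ c ∷ []
        only w b≁w with b ≟ w
        ... | yes refl = here refl
        ... | no b≢w with listed b w b≢w b≁w
        ...   | forward = contradiction refl a≢b
        ...   | backward = there (here refl)
        ...   | later forward = there (there (here refl))
        ...   | later backward = contradiction refl b≢c
      sum≡5 : codeg G a + codeg G b + [ adj G a b ] ≡ 5
      sum≡5 = cong₂ _+_ (cong₂ _+_ codeg-a codeg-b) ([]-false a≁b)

    -- Necessity of the two conditions

    module _ (mp-G : mp) where

      codeg-sum-≤ : ∀ {a b} → a ≢ b → codeg G a + codeg G b + [ adj G a b ] ≤ 5
      codeg-sum-≤ {a} {b} a≢b = ≮⇒≥ λ 5<sum → isolate-¬HasPMorAPM G a≢b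
        (proj₂ mp-G (isolate G a≢b) (isolate-⊆ G a≢b)
          (subst (_< 2 * n ∸ 5) (sym (edgeCount-∸ G (isolate G a≢b) (isolate-⊆ G a≢b)))
            (+-cancelʳ-< 5 _ _ (begin-strict
              deletedEdges G (isolate G a≢b) + 5
                <⟨ +-monoʳ-< (deletedEdges G (isolate G a≢b)) 5<sum ⟩
              deletedEdges G (isolate G a≢b) + (codeg G a + codeg G b + [ adj G a b ])
                ≡⟨ deletedEdges-isolate G a≢b ⟩
              2 * n
                ≡⟨ 2n∸5+5 ⟨
              2 * n ∸ 5 + 5 ∎))))
        where open ≤-Reasoning

      -- Isolating two vertices cannot exclude K_n and K_n minus an edge, since it costs more than
      -- `2 * n - 5` there. The existence result does: with at most one non-edge, deleting
      -- `2 * n - 5` edges leaves at most `2 * n - 4` missing.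
      two-nonEdges : ¬ nonEdges G ≤ 1
      two-nonEdges few = let (H , H⊆G , deleted , ¬has) , _ = mp-G in
        ¬has (few-nonEdges⇒HasPMorAPM H (begin
          4 + nonEdges H                        ≤⟨ +-monoʳ-≤ 4 (nonEdges-≤ G H) ⟩
          4 + (deletedEdges G H + nonEdges G)   ≤⟨ +-monoʳ-≤ 4 (+-monoʳ-≤ (deletedEdges G H) few) ⟩
          4 + (deletedEdges G H + 1)            ≡⟨ eq (deletedEdges G H) ⟩
          deletedEdges G H + 5                  ≡⟨ cong (_+ 5) (trans (sym (edgeCount-∸ G H H⊆G)) deleted) ⟩
          2 * n ∸ 5 + 5                         ≡⟨ 2n∸5+5 ⟩
          2 * n                                 ∎))
        where
        open ≤-Reasoning
        eq : ∀ D → 4 + (D + 1) ≡ D + 5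
        eq = solve-∀

      codeg₂ : ∀ {v w} → v ≢ w → adj G v w ≡ false → 2 ≤ codeg G v
      codeg₂ {v} v≢w v≁w = codeg-≥ G ((v≢w ∷ []) ∷ [] ∷ []) λ where
        _ (here refl) → irrefl G v
        _ (there (here refl)) → v≁w

      codeg₃ : ∀ {v w x} → v ≢ w → v ≢ x → w ≢ x → adj G v w ≡ false → adj G v x ≡ false → 3 ≤ codeg G v
      codeg₃ {v} v≢w v≢x w≢x v≁w v≁x = codeg-≥ G ((v≢w ∷ v≢x ∷ []) ∷ (w≢x ∷ []) ∷ [] ∷ []) λ where
        _ (here refl) → irrefl G v
        _ (there (here refl)) → v≁w
        _ (there (there (here refl))) → v≁x

      too-many : ∀ {a b p q r} → a ≢ b → p ≤ codeg G a → q ≤ codeg G b → r ≤ [ adj G a b ] → ¬ 6 ≤ p + q + r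
      too-many a≢b p≤ q≤ r≤ 6≤ = <⇒≱ 6≤ (≤-trans (+-mono-≤ (+-mono-≤ p≤ q≤) r≤) (codeg-sum-≤ a≢b))

      codeg≥3⇒P₃-complement : ∀ b → 3 ≤ codeg G b → P₃-complement
      codeg≥3⇒P₃-complement b 3≤b
        with a , a∉b , b≁a ← find-nonneighbour G {b} ([] ∷ []) (≤-trans (n≤1+n 2) 3≤b)
        with b≢a ← a∉b ∘ here ∘ sym
        with c , c∉ba , b≁c ← find-nonneighbour G {b} ((b≢a ∷ []) ∷ [] ∷ []) 3≤b
        = a , b , c , b≢a ∘ sym , b≢c , a≢c , λ i j i≢j → only i j i≢j , nonEdge i j
        where
        b≢c : b ≢ c
        b≢c = c∉ba ∘ here ∘ sym
        a≢c : a ≢ c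
        a≢c = c∉ba ∘ there ∘ here ∘ sym
        -- A third non-neighbour of `b` would give the pair `b`, `j` a sum of at least 4 + 2.
        end : ∀ {j} → b ≢ j → adj G b j ≡ false → j ≡ a ⊎ j ≡ c
        end {j} b≢j b≁j with j ≟ a | j ≟ c
        ... | yes j≡a | _ = inj₁ j≡a
        ... | no _ | yes j≡c = inj₂ j≡c
        ... | no j≢a | no j≢c = contradiction (s≤s (s≤s (s≤s (s≤s (s≤s (s≤s z≤n))))))
          (too-many b≢j 4≤b (codeg₂ (b≢j ∘ sym) (G≁ b≁j)) z≤n)
          where
          4≤b : 4 ≤ codeg G b
          4≤b = codeg-≥ G
            ((b≢a ∷ b≢c ∷ b≢j ∷ []) ∷ (a≢c ∷ (j≢a ∘ sym) ∷ []) ∷ ((j≢c ∘ sym) ∷ []) ∷ [] ∷ []) λ where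
            _ (here refl) → irrefl G b
            _ (there (here refl)) → b≁a
            _ (there (there (here refl))) → b≁c
            _ (there (there (there (here refl)))) → b≁j
        -- A non-edge avoiding `b` is too much for the pair `b`, `i`: 3 + 2 + 1 if they are
        -- adjacent, and 3 + 3 + 0 if not, as then `i` misses both `j` and `b`.
        centre : ∀ i j → i ≢ j → adj G i j ≡ false → i ≢ b → j ≢ b → ⊥
        centre i j i≢j i≁j i≢b j≢b with adj G b i in b~i
        ... | true = too-many (i≢b ∘ sym) 3≤b (codeg₂ i≢j i≁j) (≤-reflexive (sym ([]-true b~i))) ≤-refl
        ... | false = too-many (i≢b ∘ sym) 3≤b (codeg₃ i≢j i≢b j≢b i≁j (G≁ b~i)) z≤n ≤-refl
        only : ∀ i j → i ≢ j → adj G i j ≡ false → SameEdge i j a b ⊎ SameEdge i j b c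
        only i j i≢j i≁j with i ≟ b | j ≟ b
        ... | no i≢b | no j≢b = ⊥-elim (centre i j i≢j i≁j i≢b j≢b)
        ... | yes refl | _ with end i≢j i≁j
        ...   | inj₁ j≡a = inj₁ (inj₂ (refl , j≡a))
        ...   | inj₂ j≡c = inj₂ (inj₁ (refl , j≡c))
        only i j i≢j i≁j | no _ | yes refl with end (i≢j ∘ sym) (G≁ i≁j)
        ...   | inj₁ i≡a = inj₁ (inj₁ (i≡a , refl))
        ...   | inj₂ i≡c = inj₂ (inj₂ (i≡c , refl))
        nonEdge : ∀ i j → SameEdge i j a b ⊎ SameEdge i j b c → adj G i j ≡ false
        nonEdge i j (inj₁ (inj₁ (refl , refl))) = G≁ b≁a
        nonEdge i j (inj₁ (inj₂ (refl , refl))) = b≁a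
        nonEdge i j (inj₂ (inj₁ (refl , refl))) = b≁c
        nonEdge i j (inj₂ (inj₂ (refl , refl))) = G≁ b≁c

      codeg≤2⇒matching-complement : (∀ v → codeg G v ≤ 2) →
        δ G ≡ n ∸ 2 × (∀ a b → ¬ IsKnMinusEdge G a b)
      codeg≤2⇒matching-complement codeg≤2 = δ≡ , λ a b (_ , minusEdge) →
        two-nonEdges (nonEdges-≤-length G ((a , b) ∷ []) λ v w v≢w v≁w →
          listed (proj₁ (minusEdge v w v≢w) v≁w))
        where
        listed : ∀ {a b v w} → SameEdge v w a b → Joined ((a , b) ∷ []) v w
        listed (inj₁ (refl , refl)) = forward
        listed (inj₂ (refl , refl)) = backward
        δ≡ : δ G ≡ n ∸ 2
        δ≡ with any? (λ v → 2 ≤? codeg G v)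
        -- If no vertex has a non-neighbour other than itself, the empty list exhausts the
        -- non-edges.
        ... | no all-full = contradiction (≤-trans (nonEdges-≤-length G [] λ v w v≢w v≁w →
                contradiction (v , codeg₂ v≢w v≁w) all-full) z≤n) two-nonEdges
        ... | yes (v , 2≤v) = ≤-antisym
          (+-cancelʳ-≤ 2 _ _ (begin
            δ G + 2              ≤⟨ +-mono-≤ (δ≤deg G v) 2≤v ⟩
            deg G v + codeg G v  ≡⟨ trans (deg+codeg G v) (sym n∸2+2) ⟩
            n ∸ 2 + 2            ∎))
          (δ-glb G (m∸n≤m n 2) λ w → +-cancelʳ-≤ 2 _ _ (begin
            n ∸ 2 + 2            ≡⟨ trans n∸2+2 (sym (deg+codeg G w)) ⟩
            deg G w + codeg G w  ≤⟨ +-monoʳ-≤ (deg G w) (codeg≤2 w) ⟩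
            deg G w + 2          ∎))
          where open ≤-Reasoning

      classify-mp : (δ G ≡ n ∸ 2 × (∀ a b → ¬ IsKnMinusEdge G a b)) ⊎ P₃-complement
      classify-mp with any? (λ b → 3 ≤? codeg G b)
      ... | yes (b , 3≤b) = inj₂ (codeg≥3⇒P₃-complement b 3≤b)
      ... | no all-≤2 = inj₁ (codeg≤2⇒matching-complement λ v → s≤s⁻¹ (≰⇒> λ 3≤v → all-≤2 (v , 3≤v)))

theorem3p9 : (n : ℕ) → n % 2 ≡ 1 → 13 ≤ n → (G : Graph n) →
    MatchingPreclusionNumber G (2 * n ∸ 5) ⇔
    ((δ G ≡ n ∸ 2 × ((a b : Fin n) → ¬ IsKnMinusEdge G a b))
    ⊎ Σ (Fin n) (λ a → Σ (Fin n) (λ b → Σ (Fin n) (λ c → IsKnMinusP3 G a b c))))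
theorem3p9 n n-odd 13≤n G = mk⇔ (classify-mp n-odd 13≤n G) λ where
  (inj₁ (δ≡ , ¬minusEdge)) → matching-complement⇒mp n-odd 13≤n G δ≡ ¬minusEdge
  (inj₂ P₃) → P₃-complement⇒mp n-odd 13≤n G P₃
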